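{- Let $\mathfrak{A}$ be a complete atomic weakly associative relation algebra and let $\mathfrak{B}=\langle B,T_\kappa,E_{\kappa\lambda}\rangle_{\kappa,\lambda<3}$ be the suitable structure of $\mathfrak{A}$. Then there is a set relation algebra $\mathfrak{A}'$ that is a subalgebra of $\mathfrak{Re}(U(\mathfrak{B}))$ such that $\mathfrak{A}\cong\mathfrak{Rl}_{S(\mathfrak{B})}(\mathfrak{A}')$, where $$S(\mathfrak{B})=\{\langle u,v\rangle: u,v\in U(\mathfrak{B}),\ \exists w\ \langle u,v,w\rangle\in V(\mathfrak{B})\}.$$
   Context: Weakly associative relation algebras (WA): an algebra $\mathfrak{A}=\langle A,+,\overline{\phantom{x}},;,\breve{\phantom{x}},1'\rangle$ (binary $+,;$; unary complement $\overline{x}$ and converse $\breve{x}$; constant $1'$), with abbreviations $x\cdot y=\overline{\overline{x}+\overline{y}}$, $0'=\overline{1'}$, $1=1'+0'$, $0=\overline{1}$, is in WA if for all $x,y,z$: $x+y=y+x$; $x+(y+z)=(x+y)+z$; $\overline{\overline{x}+\overline{y}}+\overline{\overline{x}+y}=x$; $((x\cdot 1');1);1=(x\cdot1');1$; $(x+y);z=x;z+y;z$; $x;1'=x$; $\breve{\breve{x}}=x$; $\breve{(x+y)}=\breve{x}+\breve{y}$; $\breve{(x;y)}=\breve{y};\breve{x}$; $\breve{x};\overline{x;y}+\overline{y}=\overline{y}$. $\le$ is the Boolean order; $\mathfrak{A}$ is complete/atomic if its Boolean reduct is; $\mathrm{At}(\mathfrak{A})$ is its set of atoms. Suitable structure of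 an atomic $\mathfrak{A}\in$ WA: $B=\{s\in{}^3\mathrm{At}(\mathfrak{A}): s_2;s_0\ge s_1\}$ (triples $s=\langle s_0,s_1,s_2\rangle$); for $\kappa<3$, $T_\kappa=\{\langle s,t\rangle\in B\times B: s_\kappa=t_\kappa\}$; $E_{\kappa\kappa}=B$; for distinct $\kappa,\lambda<3$ with $\mu$ the third element of $\{0,1,2\}$, $E_{\kappa\lambda}=\{s\in B:s_\mu\le 1'\}$. Trails: a $\mathfrak{B}$-trail is a sequence $p=\langle t_0,\kappa_0,\dots,t_n,\kappa_n\rangle$ with $n\in\omega$, $t_i\in B$, $\kappa_i<3$, and $t_i\ne t_{i+1}$, $\langle t_i,t_{i+1}\rangle\in T_{\kappa_i}$ for all $i<n$; $p$ ends at $t_n$. $\mathrm{Tr}(\mathfrak{B})$ is the set of trails. For $\lambda<3$, $p\lambda=\langle t_0,\kappa_0,\dots,t_{n-1},\kappa_{n-1},t_n,\lambda\rangle$. Let $\approx$ be the smallest equivalence relation on $\mathrm{Tr}(\mathfrak{B})$ such that (whenever the displayed sequences are trails): (a) $\langle t_0,\kappa_0,\dots,t_i,\lambda,s,\lambda,t_i,\kappa_i,\dots,t_n,\kappa_n\rangle\approx\langle t_0,\kappa_0,\dots,t_i,\kappa_i,\dots,t_n,\kappa_n\rangle$ ($0\le i\le n$); (b) $\langle t_0,\kappa_0,\dots,t_n,\lambda,s,\nu\rangle\approx\langle t_0,\kappa_0,\dots,t_n,\nu\rangle$ whenever $\lambda\neq\nu$; (c) $\langle t_0,\kappa_0,\dots,t_n,\lambda\rangle\approx\langle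 t_0,\kappa_0,\dots,t_n,\kappa_n\rangle$ whenever $t_n\in E_{\lambda\kappa_n}$. $p^{\mathfrak{B}}$ is the $\approx$-class of $p$; $U(\mathfrak{B})=\{p^{\mathfrak{B}}:p\in\mathrm{Tr}(\mathfrak{B})\}$; for $t\in B$, $R_t=\{\langle(p0)^{\mathfrak{B}},(p1)^{\mathfrak{B}},(p2)^{\mathfrak{B}}\rangle: p\in\mathrm{Tr}(\mathfrak{B})\text{ ends at }t\}$; $V(\mathfrak{B})=\bigcup_{t\in B}R_t$. $\mathfrak{Re}(U)=\langle\mathcal{P}(U\times U),\cup,U\times U\setminus\cdot,|,{}^{ -1},Id_U\rangle$ is the algebra of all binary relations on $U$ (union, complement, relational composition, inverse, identity). A set relation algebra is a subalgebra of some $\mathfrak{Re}(U)$. For a subalgebra $\mathfrak{A}'$ of $\mathfrak{Re}(U)$ and $E\subseteq U\times U$, the relativization $\mathfrak{Rl}_E(\mathfrak{A}')$ has universe $\{R\cap E:R\in A'\}$ and operations $R+S=(R\cup S)\cap E$, $\overline{R}=(U\times U\setminus R)\cap E$, $R;S=(R|S)\cap E$, $\breve{R}=R^{ -1}\cap E$, $1'=Id_U\cap E$. -}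

module Defs where

open import Level using (Level; _⊔_; suc)
open import Data.Fin.Base using (Fin)
open import Data.Fin.Patterns using (0F; 1F; 2F)
open import Data.List.Base using (List; []; _∷_; [_]; _++_; _∷ʳ_)
open import Data.List.Relation.Binary.Pointwise.Base using (Pointwise)
open import Data.List.Relation.Unary.Linked using (Linked; [-]; _∷_)
open import Data.Product using (Σ; ∃; ∃-syntax; _×_; _,_; proj₁; proj₂)
import Data.Product as Prod
import Data.Sum as Sum
open import Data.Sum using (_⊎_)
open import Function.Base using (_on_; flip)
open import Function.Definitions using (Congruent; Bijective)
import Relation.Binary.Construct.Closure.Equivalence as EqC
import Relation.Binary.Construct.On as On
open import Relation.Binary.Construct.Composition using (_;_)
open import Relation.Binary.Construct.Intersection using (_∩_)
open import Relation.Binary.Construct.Union using (_∪_)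
open import Relation.Binary.Bundles using (Setoid)
open import Relation.Binary.Core using (Rel; _⇔_)
open import Relation.Binary.Definitions using (_Respects_; _Respects₂_)
open import Relation.Binary.PropositionalEquality.Core using (_≡_; _≢_)
open import Relation.Binary.Structures using (IsEquivalence)
open import Relation.Nullary using (¬_)
open import Relation.Unary using (Pred; _∈_)

private
  variable
    a b c ℓ ℓ′ p : Level

------------------------------------------------------------------------
-- Algebras of the similarity type of relation algebras

record Algebra (c ℓ : Level) : Set (suc (c ⊔ ℓ)) where
  infix  8 _˘
  infix  8 -_
  infixl 7 _⨾_
  infixl 7 _·_
  infixl 6 _+_
  infix  4 _≈_ _≉_ _≤_
  field
    Carrier       : Set c
    _≈_           : Rel Carrier ℓ
    isEquivalence : IsEquivalence _≈_
    _+_           : Carrier → Carrier → Carrier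
    -_            : Carrier → Carrier
    _⨾_           : Carrier → Carrier → Carrier
    _˘            : Carrier → Carrier
    1'            : Carrier
    +-cong        : ∀ {x y u v} → x ≈ y → u ≈ v → x + u ≈ y + v
    -‿cong        : ∀ {x y} → x ≈ y → - x ≈ - y
    ⨾-cong        : ∀ {x y u v} → x ≈ y → u ≈ v → x ⨾ u ≈ y ⨾ v
    ˘-cong        : ∀ {x y} → x ≈ y → x ˘ ≈ y ˘

  setoid : Setoid c ℓ
  setoid = record { isEquivalence = isEquivalence }

  open IsEquivalence isEquivalence public

  _≉_ : Rel Carrier ℓ
  x ≉ y = ¬ (x ≈ y)

  _·_ : Carrier → Carrier → Carrier
  x · y = - (- x + - y)

  0' : Carrier
  0' = - 1'

  1# : Carrier
  1# = 1' + 0'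

  0# : Carrier
  0# = - 1#

  _≤_ : Rel Carrier ℓ
  x ≤ y = x + y ≈ y

------------------------------------------------------------------------
-- Subalgebras and isomorphisms

record IsSubuniverse (𝔄 : Algebra c ℓ) (P : Pred (Algebra.Carrier 𝔄) p)
       : Set (c ⊔ ℓ ⊔ p) where
  open Algebra 𝔄
  field
    respects  : P Respects _≈_
    +-closed  : ∀ {x y} → x ∈ P → y ∈ P → (x + y) ∈ P
    -‿closed  : ∀ {x} → x ∈ P → (- x) ∈ P
    ⨾-closed  : ∀ {x y} → x ∈ P → y ∈ P → (x ⨾ y) ∈ P
    ˘-closed  : ∀ {x} → x ∈ P → (x ˘) ∈ P
    1'-closed : 1' ∈ P

record Subalgebra (𝔄 : Algebra c ℓ) (p : Level) : Set (c ⊔ ℓ ⊔ suc p) where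
  field
    universe      : Pred (Algebra.Carrier 𝔄) p
    isSubuniverse : IsSubuniverse 𝔄 universe

  open IsSubuniverse isSubuniverse public

  algebra : Algebra (c ⊔ p) ℓ
  algebra = record
    { Carrier       = Σ Carrier universe
    ; _≈_           = _≈_ on proj₁
    ; isEquivalence = On.isEquivalence proj₁ isEquivalence
    ; _+_           = Prod.zip _+_ +-closed
    ; -_            = Prod.map -_ -‿closed
    ; _⨾_           = Prod.zip _⨾_ ⨾-closed
    ; _˘            = Prod.map _˘ ˘-closed
    ; 1'            = 1' , 1'-closed
    ; +-cong        = +-cong
    ; -‿cong        = -‿cong
    ; ⨾-cong        = ⨾-cong
    ; ˘-cong        = ˘-cong
    }
    where open Algebra 𝔄

infix 4 _≅_

record _≅_ (𝔄 : Algebra a ℓ) (𝔅 : Algebra b ℓ′) : Set (a ⊔ b ⊔ ℓ ⊔ ℓ′) where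
  private
    module A = Algebra 𝔄
    module B = Algebra 𝔅
  field
    ⟦_⟧       : A.Carrier → B.Carrier
    cong      : Congruent A._≈_ B._≈_ ⟦_⟧
    bijective : Bijective A._≈_ B._≈_ ⟦_⟧
    +-homo    : ∀ x y → ⟦ x A.+ y ⟧ B.≈ ⟦ x ⟧ B.+ ⟦ y ⟧
    -‿homo    : ∀ x → ⟦ A.- x ⟧ B.≈ B.- ⟦ x ⟧
    ⨾-homo    : ∀ x y → ⟦ x A.⨾ y ⟧ B.≈ ⟦ x ⟧ B.⨾ ⟦ y ⟧
    ˘-homo    : ∀ x → ⟦ x A.˘ ⟧ B.≈ ⟦ x ⟧ B.˘
    1'-homo   : ⟦ A.1' ⟧ B.≈ B.1'

------------------------------------------------------------------------
-- Weakly associative relation algebras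

record WA (c ℓ : Level) : Set (suc (c ⊔ ℓ)) where
  field
    algebra : Algebra c ℓ

  open Algebra algebra public

  field
    +-comm       : ∀ x y → x + y ≈ y + x
    +-assoc      : ∀ x y z → x + (y + z) ≈ (x + y) + z
    huntington   : ∀ x y → - (- x + - y) + - (- x + y) ≈ x
    weakAssoc    : ∀ x → ((x · 1') ⨾ 1#) ⨾ 1# ≈ (x · 1') ⨾ 1#
    ⨾-distribʳ-+ : ∀ x y z → (x + y) ⨾ z ≈ x ⨾ z + y ⨾ z
    ⨾-identityʳ  : ∀ x → x ⨾ 1' ≈ x
    ˘-involutive : ∀ x → (x ˘) ˘ ≈ x
    ˘-distrib-+  : ∀ x y → (x + y) ˘ ≈ x ˘ + y ˘
    ˘-anti-⨾     : ∀ x y → (x ⨾ y) ˘ ≈ y ˘ ⨾ x ˘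
    tarski       : ∀ x y → x ˘ ⨾ (- (x ⨾ y)) + - y ≈ - y

module _ (𝔄 : WA c ℓ) where
  open WA 𝔄

  IsAtom : Pred Carrier (c ⊔ ℓ)
  IsAtom x = x ≉ 0# × (∀ y → y ≤ x → y ≈ 0# ⊎ y ≈ x)

  Atomic : Set (c ⊔ ℓ)
  Atomic = ∀ x → x ≉ 0# → ∃[ y ] IsAtom y × y ≤ x

  IsSupremum : Pred Carrier p → Pred Carrier (c ⊔ ℓ ⊔ p)
  IsSupremum P s = (∀ x → x ∈ P → x ≤ s)
                 × (∀ z → (∀ x → x ∈ P → x ≤ z) → s ≤ z)

  Complete : Set (suc (c ⊔ ℓ))
  Complete = (P : Pred Carrier (c ⊔ ℓ)) → P Respects _≈_ → ∃ (IsSupremum P)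

  At : Setoid (c ⊔ ℓ) ℓ
  At = On.setoid {B = ∃ IsAtom} setoid proj₁

------------------------------------------------------------------------
-- Structures ⟨B, T_κ, E_κλ⟩, trails and the relations they give rise to

record Structure (b ℓ : Level) : Set (suc (b ⊔ ℓ)) where
  field
    B      : Setoid b ℓ
    T      : Fin 3 → Rel (Setoid.Carrier B) ℓ
    E      : Fin 3 → Fin 3 → Pred (Setoid.Carrier B) ℓ
    T-resp : ∀ κ → T κ Respects₂ Setoid._≈_ B
    E-resp : ∀ κ ι → E κ ι Respects Setoid._≈_ B

-- Relations on a set are relations on a setoid that respect its equality;
-- they are compared extensionally.

record BinRel (U : Setoid a ℓ) : Set (suc (a ⊔ ℓ)) where
  constructor binRel
  open Setoid U
  field
    rel  : Rel Carrier (a ⊔ ℓ)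
    resp : ∀ {u u′ v v′} → u ≈ u′ → v ≈ v′ → rel u v → rel u′ v′

infix 4 _≐_

record _≐_ {U : Setoid a ℓ} (R S : BinRel U) : Set (a ⊔ ℓ) where
  constructor ext
  field
    rel⇔ : BinRel.rel R ⇔ BinRel.rel S

module Trails (𝔅 : Structure b ℓ) where
  open Structure 𝔅
  open Setoid B using (Carrier; _≈_; _≉_)

  Step : Set b
  Step = Carrier × Fin 3

  _↝_ : Rel Step ℓ
  (t , κ) ↝ (t′ , _) = t ≉ t′ × T κ t t′

  record Trail : Set (b ⊔ ℓ) where
    constructor trail
    field
      front    : List Step
      end      : Carrier
      label    : Fin 3
      isLinked : Linked _↝_ (front ∷ʳ (end , label))

    steps : List Step
    steps = front ∷ʳ (end , label)

  open Trail public

  private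
    relink : ∀ xs {t κ ι} → Linked _↝_ (xs ∷ʳ (t , κ)) →
             Linked _↝_ (xs ∷ʳ (t , ι))
    relink []           [-]      = [-]
    relink (_ ∷ [])     (r ∷ _)  = r ∷ [-]
    relink (_ ∷ y ∷ xs) (r ∷ rs) = r ∷ relink (y ∷ xs) rs

  infixl 7 _▹_

  _▹_ : Trail → Fin 3 → Trail
  trail xs t κ l ▹ ι = trail xs t ι (relink xs l)

  _EndsAt_ : Trail → Pred Carrier ℓ
  p EndsAt t = end p ≈ t

  -- `same` identifies sequences that are equal up to the equality of B.

  data _⟶_ : List Step → List Step → Set (b ⊔ ℓ) where
    same      : ∀ {xs ys} →
                Pointwise (λ x y → proj₁ x ≈ proj₁ y × proj₂ x ≡ proj₂ y) xs ys →
                xs ⟶ ys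
    backtrack : ∀ xs t ι s κ ys →
                (xs ++ (t , ι) ∷ (s , ι) ∷ (t , κ) ∷ ys) ⟶ (xs ++ (t , κ) ∷ ys)
    drop      : ∀ xs t ι s ν → ι ≢ ν →
                (xs ++ (t , ι) ∷ (s , ν) ∷ []) ⟶ (xs ++ (t , ν) ∷ [])
    merge     : ∀ xs t ι κ → t ∈ E ι κ →
                (xs ++ (t , ι) ∷ []) ⟶ (xs ++ (t , κ) ∷ [])

  -- The quotient of the set of trails by the least equivalence relation
  -- containing the rules above; all intermediate sequences are trails.

  U : Setoid (b ⊔ ℓ) (b ⊔ ℓ)
  U = EqC.setoid {A = Trail} (_⟶_ on steps)

  private
    module U = Setoid U

  R : Carrier → U.Carrier → U.Carrier → U.Carrier → Set (b ⊔ ℓ)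
  R t u v w = ∃[ p ] p EndsAt t × u U.≈ p ▹ 0F × v U.≈ p ▹ 1F × w U.≈ p ▹ 2F

  V : U.Carrier → U.Carrier → U.Carrier → Set (b ⊔ ℓ)
  V u v w = ∃[ t ] R t u v w

  S : BinRel U
  S = binRel (λ u v → ∃[ w ] V u v w)
    λ { u≈u′ v≈v′ (w , t , p , e , u≈ , v≈ , w≈) →
        w , t , p , e , U.trans (U.sym u≈u′) u≈ , U.trans (U.sym v≈v′) v≈ , w≈ }

------------------------------------------------------------------------
-- The suitable structure

module _ (𝔄 : WA c ℓ) where
  open WA 𝔄

  infix 9 _⟨_⟩

  Triangle : Set (c ⊔ ℓ)
  Triangle = Σ (Fin 3 → Setoid.Carrier (At 𝔄)) λ s →
               proj₁ (s 1F) ≤ proj₁ (s 2F) ⨾ proj₁ (s 0F)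

  _⟨_⟩ : Triangle → Fin 3 → Carrier
  (s , _) ⟨ κ ⟩ = proj₁ (s κ)

  private
    B : Setoid (c ⊔ ℓ) ℓ
    B = record
      { Carrier       = Triangle
      ; _≈_           = λ s t → ∀ κ → s ⟨ κ ⟩ ≈ t ⟨ κ ⟩
      ; isEquivalence = record
        { refl  = λ _ → refl
        ; sym   = λ eq κ → sym (eq κ)
        ; trans = λ eq₁ eq₂ κ → trans (eq₁ κ) (eq₂ κ)
        }
      }

  data SuitableE (κ ι : Fin 3) (s : Triangle) : Set ℓ where
    diagonal    : κ ≡ ι → SuitableE κ ι s
    offDiagonal : ∀ μ → κ ≢ ι → μ ≢ κ → μ ≢ ι → s ⟨ μ ⟩ ≤ 1' → SuitableE κ ι s

  suitableStructure : Structure (c ⊔ ℓ) ℓ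
  suitableStructure = record
    { B      = B
    ; T      = λ κ s t → s ⟨ κ ⟩ ≈ t ⟨ κ ⟩
    ; E      = SuitableE
    ; T-resp = λ κ → (λ t≈t′ eq → trans eq (t≈t′ κ))
                   , (λ s≈s′ eq → trans (sym (s≈s′ κ)) eq)
    ; E-resp = λ { κ ι s≈t (diagonal κ≡ι) → diagonal κ≡ι
                 ; κ ι s≈t (offDiagonal μ κ≢ι μ≢κ μ≢ι s≤1') →
                     offDiagonal μ κ≢ι μ≢κ μ≢ι
                       (trans (+-cong (sym (s≈t μ)) refl) s≤1') }
    }

------------------------------------------------------------------------
-- Algebras of binary relations

module _ (U : Setoid a ℓ) where
  private
    module U = Setoid U
  open BinRel

  Re : Algebra (suc (a ⊔ ℓ)) (a ⊔ ℓ)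
  Re = record
    { Carrier       = BinRel U
    ; _≈_           = _≐_
    ; isEquivalence = record
      { refl  = ext ((λ r → r) , (λ r → r))
      ; sym   = λ { (ext (f , g)) → ext (g , f) }
      ; trans = λ { (ext (f , g)) (ext (h , k)) →
                    ext ((λ r → h (f r)) , (λ r → g (k r))) }
      }
    ; _+_           = λ R S → binRel (rel R ∪ rel S)
                        λ u≈ v≈ → Sum.map (resp R u≈ v≈) (resp S u≈ v≈)
    ; -_            = λ R → binRel (λ u v → ¬ rel R u v)
                        λ u≈ v≈ ¬r r → ¬r (resp R (U.sym u≈) (U.sym v≈) r)
    ; _⨾_           = λ R S → binRel (rel R ; rel S)
                        λ { u≈ v≈ (w , r , s) →
                            w , resp R u≈ U.refl r , resp S U.refl v≈ s }
    ; _˘            = λ R → binRel (flip (rel R)) λ u≈ v≈ → resp R v≈ u≈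
    ; 1'            = binRel (λ u v → Level.Lift a (u U.≈ v))
                        λ { u≈ v≈ (Level.lift u≈v) →
                            Level.lift (U.trans (U.sym u≈) (U.trans u≈v v≈)) }
    ; +-cong        = λ { (ext (f , g)) (ext (h , k)) →
                          ext (Sum.map f h , Sum.map g k) }
    ; -‿cong        = λ { (ext (f , g)) →
                          ext ((λ ¬r s → ¬r (g s)) , (λ ¬s r → ¬s (f r))) }
    ; ⨾-cong        = λ { (ext (f , g)) (ext (h , k)) →
                          ext ( (λ (w , r , s) → w , f r , h s)
                              , (λ (w , r , s) → w , g r , k s) ) }
    ; ˘-cong        = λ { (ext (f , g)) → ext ((λ r → f r) , (λ r → g r)) }
    }

module _ {U : Setoid a ℓ} where
  open BinRel
  private
    module Re = Algebra (Re U)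

  infixl 7 _⊓_

  _⊓_ : BinRel U → BinRel U → BinRel U
  R ⊓ S = binRel (rel R ∩ rel S)
            λ u≈ v≈ → Prod.map (resp R u≈ v≈) (resp S u≈ v≈)

  private
    ⊓-congʳ : ∀ E {R S : BinRel U} → R Re.≈ S → R ⊓ E Re.≈ S ⊓ E
    ⊓-congʳ E (ext (f , g)) = ext (Prod.map₁ f , Prod.map₁ g)

  RlOperations : BinRel U → Algebra (suc (a ⊔ ℓ)) (a ⊔ ℓ)
  RlOperations E = record
    { Carrier       = BinRel U
    ; _≈_           = Re._≈_
    ; isEquivalence = Re.isEquivalence
    ; _+_           = λ R S → (R Re.+ S) ⊓ E
    ; -_            = λ R → (Re.- R) ⊓ E
    ; _⨾_           = λ R S → (R Re.⨾ S) ⊓ E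
    ; _˘            = λ R → (R Re.˘) ⊓ E
    ; 1'            = Re.1' ⊓ E
    ; +-cong        = λ p q → ⊓-congʳ E (Re.+-cong p q)
    ; -‿cong        = λ p → ⊓-congʳ E (Re.-‿cong p)
    ; ⨾-cong        = λ p q → ⊓-congʳ E (Re.⨾-cong p q)
    ; ˘-cong        = λ p → ⊓-congʳ E (Re.˘-cong p)
    }

  RlUniverse : BinRel U → Subalgebra (Re U) p → Pred (BinRel U) (suc (a ⊔ ℓ) ⊔ p)
  RlUniverse E 𝔄′ X = ∃[ R ] R ∈ Subalgebra.universe 𝔄′ × X Re.≈ R ⊓ E

  -- For arbitrary E the relativized operations may lead out of
  -- { R ∩ E : R ∈ A′ }, so Rl_E(𝔄′) is an algebra only given closure.

  RlClosed : BinRel U → Subalgebra (Re U) p → Set (suc (a ⊔ ℓ) ⊔ p)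
  RlClosed E 𝔄′ = IsSubuniverse (RlOperations E) (RlUniverse E 𝔄′)

  Rl : (E : BinRel U) (𝔄′ : Subalgebra (Re U) p) → RlClosed E 𝔄′ →
       Algebra (suc (a ⊔ ℓ) ⊔ p) (a ⊔ ℓ)
  Rl E 𝔄′ closed = Subalgebra.algebra
    record { universe = RlUniverse E 𝔄′ ; isSubuniverse = closed }

module Submission where

open import Defs
open import Level using (Level; _⊔_; suc)
open import Axiom.ExcludedMiddle using (ExcludedMiddle)
open import Algebra.Bundles using (CommutativeSemigroup)
import Algebra.Properties.CommutativeSemigroup as CommutativeSemigroupProperties
open import Data.Fin.Base using (Fin)
open import Data.Fin.Patterns using (0F; 1F; 2F)
open import Data.Empty.Polymorphic using (⊥)
open import Data.Product using (∃; ∃-syntax; Σ-syntax; _×_; _,_; proj₁; proj₂)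
open import Data.Fin.Properties using (_≟_)
open import Data.List.Base using (List; []; _∷_; _++_; _∷ʳ_; foldl)
open import Data.List.Properties using (++-assoc; foldl-++)
open import Data.List.Relation.Binary.Pointwise.Base using (Pointwise; []; _∷_)
open import Data.List.Relation.Unary.Linked using (Linked; []; [-]; _∷_)
open import Data.Unit.Polymorphic using (⊤)
open import Function.Base using (_on_)
import Relation.Binary.Construct.Closure.Equivalence as EqC
open import Relation.Binary.Construct.Closure.Equivalence using (return)
open import Relation.Binary.Construct.Closure.ReflexiveTransitive using (ε; _◅_)
open import Relation.Binary.Construct.Closure.Symmetric using (SymClosure; fwd; bwd)
import Data.Sum as Sum
open import Data.Sum using (_⊎_; inj₁; inj₂; [_,_]′)
open import Relation.Binary.Bundles using (Poset; Setoid)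
import Relation.Binary.Reasoning.Setoid as SetoidReasoning
import Relation.Binary.Reasoning.PartialOrder as PosetReasoning
open import Relation.Binary.PropositionalEquality.Core as ≡ using (_≡_; _≢_)
open import Relation.Nullary using (¬_; Dec; yes; no; contradiction)

-- To x corresponds the set h x of pairs (p0, p1) such that p ends at a triangle t with t₂ ≤ x,
-- and 𝔄′ consists of the relations invariant under the deck transformations of the forest of
-- triangles, that is, under re-rooting of trails.  An invariant relation holds at (p0, p1) iff it
-- holds at the two vertices of the one-triangle trail on the end of p, and there it depends only
-- on t₂; by completeness its restriction to S is therefore some h x.  Conversely h x, h x | h y
-- and Id are invariant, so that for the nontrivial inclusions one may assume the point p0 to be
-- the vertex 0 of a one-triangle trail.  Assigning to each point adjacent to that vertex the
-- atom labelling the edge is compatible with ≈: along reduced trails such labels can be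
-- propagated step by step, coherently with every triangle met on the way.

-- Composition of atoms is multivalued and not associative, so a label cannot be carried along a
-- path in general. Labels are therefore partial and form a relation: a new vertex is labelled only
-- where one of the two atoms to be composed is an identity, which forces the result. An identity
-- edge makes its two ends the same point. A labelling has to respect this in two ways, when the
-- fixed point coincides with a vertex and when two vertices of one triangle coincide. Identities
-- behave like points because, by weak associativity, all atoms leaving a point have the same
-- domain.
--
-- Two points are told apart by an invariant, not by normal forms: labels are computed from raw
-- trails by a stack that pops whenever a step undoes the previous one, and every generating rule of
-- the equivalence is checked to preserve them. On the other side, invariance is demanded only under
-- the swaps of two neighbouring roots, which already suffice to strip a trail down to its last
-- triangle. Excluded middle decides equality of triangles throughout.

private
  variable
    c ℓ : Level

-- Boolean algebra from Huntington's axiom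

module BooleanLaws (𝔄 : WA c ℓ) where
  open WA 𝔄
  open SetoidReasoning setoid

  +-commutativeSemigroup : CommutativeSemigroup c ℓ
  +-commutativeSemigroup = record
    { isCommutativeSemigroup = record
      { isSemigroup = record
        { isMagma = record { isEquivalence = isEquivalence ; ∙-cong = +-cong }
        ; assoc   = λ x y z → sym (+-assoc x y z)
        }
      ; comm = +-comm
      }
    }

  open CommutativeSemigroupProperties +-commutativeSemigroup using (interchange)

  +-congˡ : ∀ {x y z} → y ≈ z → x + y ≈ x + z
  +-congˡ = +-cong refl

  +-congʳ : ∀ {x y z} → y ≈ z → y + x ≈ z + x
  +-congʳ eq = +-cong eq refl

  -- Expanding both summands on the left by `- - x`, and both on the right by `- x`, yields the same
  -- four terms `A`, `B`, `C`, `D` up to commutativity.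
  x+-x≈-x+--x : ∀ x → x + - x ≈ - x + - - x
  x+-x≈-x+--x x = begin
    x + - x
      ≈⟨ +-cong (huntington x (- - x)) (huntington (- x) (- - x)) ⟨
    (A + B) + (C + D)
      ≈⟨ +-comm _ _ ⟩
    (C + D) + (A + B)
      ≈⟨ +-cong (+-comm _ _) (+-comm _ _) ⟩
    (D + C) + (B + A)
      ≈⟨ interchange D C B A ⟩
    (D + B) + (C + A)
      ≈⟨ +-cong (+-congˡ (-‿cong (+-comm _ _))) (+-cong (-‿cong (+-comm _ _)) (-‿cong (+-comm _ _))) ⟩
    (D + - (- - x + - x)) + (- (- - - x + - - x) + - (- - - x + - x))
      ≈⟨ +-cong (huntington (- x) (- x)) (huntington (- - x) (- x)) ⟩
    - x + - - x ∎
    where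
    A = - (- x + - - - x)
    B = - (- x + - - x)
    C = - (- - x + - - - x)
    D = - (- - x + - - x)

  -‿involutive : ∀ x → - - x ≈ x
  -‿involutive x = begin
    - - x
      ≈⟨ huntington (- - x) (- x) ⟨
    - (- - - x + - - x) + - (- - - x + - x)
      ≈⟨ +-cong (-‿cong (trans (+-comm _ _) (sym (x+-x≈-x+--x (- x))))) (-‿cong (+-comm _ _)) ⟩
    - (- x + - - x) + - (- x + - - - x)
      ≈⟨ +-comm _ _ ⟩
    - (- x + - - - x) + - (- x + - - x)
      ≈⟨ huntington x (- - x) ⟩
    x ∎

  huntington⁻ : ∀ x y → - (x + - y) + - (x + y) ≈ - x
  huntington⁻ x y = begin
    - (x + - y) + - (x + y)
      ≈⟨ +-cong (-‿cong (+-congʳ (-‿involutive x))) (-‿cong (+-congʳ (-‿involutive x))) ⟨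
    - (- - x + - y) + - (- - x + y)
      ≈⟨ huntington (- x) y ⟩
    - x ∎

  -- Each side is the sum of the four Huntington components determined by `x` and `y`.
  x+-x≈y+-y : ∀ x y → x + - x ≈ y + - y
  x+-x≈y+-y x y = begin
    x + - x
      ≈⟨ +-cong (huntington x y) (huntington⁻ x y) ⟨
    (- (- x + - y) + - (- x + y)) + (- (x + - y) + - (x + y))
      ≈⟨ interchange _ _ _ _ ⟩
    (- (- x + - y) + - (x + - y)) + (- (- x + y) + - (x + y))
      ≈⟨ +-cong (+-cong (-‿cong (+-comm _ _)) (-‿cong (+-comm _ _)))
                (+-cong (-‿cong (+-comm _ _)) (-‿cong (+-comm _ _))) ⟩
    (- (- y + - x) + - (- y + x)) + (- (y + - x) + - (y + x))
      ≈⟨ +-cong (huntington y x) (huntington⁻ y x) ⟩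
    y + - y ∎

  x+-x≈1 : ∀ x → x + - x ≈ 1#
  x+-x≈1 x = x+-x≈y+-y x 1'

  -- Let w be `- (1# + 1#)`. Huntington's axiom gives 0 = 0 + w, so `1#` absorbs w. Hence 1 + 1 = (1
  -- + 1) + w, which is an element plus its complement.
  1+1≈1 : 1# + 1# ≈ 1#
  1+1≈1 = begin
    1# + 1#                    ≈⟨ +-congˡ 1+w≈1 ⟨
    1# + (1# + - (1# + 1#))    ≈⟨ +-assoc _ _ _ ⟩
    (1# + 1#) + - (1# + 1#)    ≈⟨ x+-x≈1 _ ⟩
    1#                         ∎
    where
    0≈0+w : 0# ≈ 0# + - (1# + 1#)
    0≈0+w = begin
      0#                               ≈⟨ huntington⁻ 1# 1# ⟨
      - (1# + 0#) + - (1# + 1#)        ≈⟨ +-congʳ (-‿cong (x+-x≈1 1#)) ⟩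
      0# + - (1# + 1#)                 ∎
    1+w≈1 : 1# + - (1# + 1#) ≈ 1#
    1+w≈1 = begin
      1# + - (1# + 1#)           ≈⟨ +-congʳ (x+-x≈1 1#) ⟨
      (1# + 0#) + - (1# + 1#)    ≈⟨ +-assoc _ _ _ ⟨
      1# + (0# + - (1# + 1#))    ≈⟨ +-congˡ 0≈0+w ⟨
      1# + 0#                    ≈⟨ x+-x≈1 1# ⟩
      1#                         ∎

  0+0≈0 : 0# + 0# ≈ 0#
  0+0≈0 = begin
    0# + 0#                      ≈⟨ +-cong (-‿cong (x+-x≈1 1#)) (-‿cong 1+1≈1) ⟨
    - (1# + 0#) + - (1# + 1#)    ≈⟨ huntington⁻ 1# 1# ⟩
    0#                           ∎

  idem-up-to-0 : ∀ x → - (- x + - x) + 0# ≈ x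
  idem-up-to-0 x = begin
    - (- x + - x) + 0#              ≈⟨ +-congˡ (-‿cong (trans (+-comm _ _) (x+-x≈1 x))) ⟨
    - (- x + - x) + - (- x + x)     ≈⟨ huntington x x ⟩
    x                               ∎

  +-identityʳ : ∀ x → x + 0# ≈ x
  +-identityʳ x = begin
    x + 0#                          ≈⟨ +-congʳ (idem-up-to-0 x) ⟨
    - (- x + - x) + 0# + 0#         ≈⟨ +-assoc _ _ _ ⟨
    - (- x + - x) + (0# + 0#)       ≈⟨ +-congˡ 0+0≈0 ⟩
    - (- x + - x) + 0#              ≈⟨ idem-up-to-0 x ⟩
    x                               ∎

  +-idem : ∀ x → x + x ≈ x
  +-idem x = begin
    x + x                      ≈⟨ -‿involutive _ ⟨
    - - (x + x)                ≈⟨ -‿cong (-‿cong (+-cong (-‿involutive x) (-‿involutive x))) ⟨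
    - - (- - x + - - x)        ≈⟨ -‿cong (trans (sym (+-identityʳ _)) (idem-up-to-0 (- x))) ⟩
    - - x                      ≈⟨ -‿involutive x ⟩
    x                          ∎

  ≤-reflexive : ∀ {x y} → x ≈ y → x ≤ y
  ≤-reflexive {_} {y} x≈y = trans (+-congʳ x≈y) (+-idem y)

  ≤-refl : ∀ {x} → x ≤ x
  ≤-refl = ≤-reflexive refl

  ≤-antisym : ∀ {x y} → x ≤ y → y ≤ x → x ≈ y
  ≤-antisym x≤y y≤x = trans (sym y≤x) (trans (+-comm _ _) x≤y)

  ≤-trans : ∀ {x y z} → x ≤ y → y ≤ z → x ≤ z
  ≤-trans {x} {y} {z} x≤y y≤z = begin
    x + z          ≈⟨ +-congˡ y≤z ⟨
    x + (y + z)    ≈⟨ +-assoc _ _ _ ⟩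
    (x + y) + z    ≈⟨ +-congʳ x≤y ⟩
    y + z          ≈⟨ y≤z ⟩
    z              ∎

  ≤-poset : Poset c ℓ ℓ
  ≤-poset = record
    { isPartialOrder = record
      { isPreorder = record
        { isEquivalence = isEquivalence
        ; reflexive     = ≤-reflexive
        ; trans         = ≤-trans
        }
      ; antisym = ≤-antisym
      }
    }

  x≤x+y : ∀ x y → x ≤ x + y
  x≤x+y x y = trans (+-assoc x x y) (+-congʳ (+-idem x))

  y≤x+y : ∀ x y → y ≤ x + y
  y≤x+y x y = ≤-trans (x≤x+y y x) (≤-reflexive (+-comm y x))

  +-least : ∀ {x y z} → x ≤ z → y ≤ z → x + y ≤ z
  +-least {x} {y} {z} x≤z y≤z =
    trans (sym (+-assoc x y z)) (trans (+-congˡ y≤z) x≤z)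

  -- If `x + y ≈ y`, then `- y` is `- (x + y)`, one of the two Huntington components of `- x`.
  -‿antitone : ∀ {x y} → x ≤ y → - y ≤ - x
  -‿antitone {x} {y} x≤y = begin
    - y + - x                              ≈⟨ +-cong (-‿cong x≤y) (huntington⁻ x y) ⟨
    - (x + y) + (- (x + - y) + - (x + y))  ≈⟨ y≤x+y _ _ ⟩
    - (x + - y) + - (x + y)                ≈⟨ huntington⁻ x y ⟩
    - x                                    ∎

  ≤-‿swap : ∀ {x y} → x ≤ - y → y ≤ - x
  ≤-‿swap {x} {y} x≤-y =
    ≤-trans (≤-reflexive (sym (-‿involutive y))) (-‿antitone x≤-y)

  x·y≤x : ∀ x y → x · y ≤ x
  x·y≤x x y = ≤-trans (x≤x+y _ _) (≤-reflexive (huntington x y))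

  x·y≤y : ∀ x y → x · y ≤ y
  x·y≤y x y = ≤-trans (-‿antitone (y≤x+y (- x) (- y))) (≤-reflexive (-‿involutive y))

  ·-greatest : ∀ {x y z} → z ≤ x → z ≤ y → z ≤ x · y
  ·-greatest z≤x z≤y = ≤-‿swap (+-least (-‿antitone z≤x) (-‿antitone z≤y))

  x≤1 : ∀ x → x ≤ 1#
  x≤1 x = ≤-trans (x≤x+y x (- x)) (≤-reflexive (x+-x≈1 x))

  0≤x : ∀ x → 0# ≤ x
  0≤x x = ≤-trans (-‿antitone (x≤1 (- x))) (≤-reflexive (-‿involutive x))

  ≤-complement⇒≈0 : ∀ {x y} → x ≤ y → x ≤ - y → x ≈ 0#
  ≤-complement⇒≈0 {x} {y} x≤y x≤-y = ≤-antisym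
    (≤-trans (·-greatest x≤y x≤-y)
      (≤-reflexive (-‿cong (trans (+-congˡ (-‿involutive y)) (trans (+-comm _ _) (x+-x≈1 y))))))
    (0≤x x)

  x·-y≈0⇒x≤y : ∀ {x y} → x · (- y) ≈ 0# → x ≤ y
  x·-y≈0⇒x≤y {x} {y} eq = ≤-trans (≤-reflexive (begin
    x                          ≈⟨ huntington x (- y) ⟨
    x · (- y) + - (- x + - y)  ≈⟨ +-congʳ eq ⟩
    0# + x · y                 ≈⟨ 0≤x _ ⟩
    x · y                      ∎)) (x·y≤y x y)

  x·y≈0⇒x≤-y : ∀ {x y} → x · y ≈ 0# → x ≤ - y
  x·y≈0⇒x≤-y eq = x·-y≈0⇒x≤y (trans (-‿cong (+-congˡ (-‿involutive _))) eq)

-- Monotonicity, converse and the Schröder rules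

module RelationLaws (𝔄 : WA c ℓ) where
  open WA 𝔄
  open BooleanLaws 𝔄

  ˘-mono : ∀ {x y} → x ≤ y → x ˘ ≤ y ˘
  ˘-mono x≤y = trans (sym (˘-distrib-+ _ _)) (˘-cong x≤y)

  ⨾-monoˡ : ∀ {x y} z → x ≤ y → x ⨾ z ≤ y ⨾ z
  ⨾-monoˡ z x≤y = trans (sym (⨾-distribʳ-+ _ _ z)) (⨾-cong x≤y refl)

  -- The axioms treat the two factors unequally; this conjugation turns a law about one side into
  -- its mirror image.
  ⨾≈˘-⨾-˘ : ∀ x y → x ⨾ y ≈ (y ˘ ⨾ x ˘) ˘
  ⨾≈˘-⨾-˘ x y = trans (sym (˘-involutive _)) (˘-cong (˘-anti-⨾ x y))

  ⨾-monoʳ : ∀ {x y} z → x ≤ y → z ⨾ x ≤ z ⨾ y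
  ⨾-monoʳ z x≤y =
    ≤-trans (≤-reflexive (⨾≈˘-⨾-˘ z _))
      (≤-trans (˘-mono (⨾-monoˡ (z ˘) (˘-mono x≤y)))
        (≤-reflexive (sym (⨾≈˘-⨾-˘ z _))))

  ⨾-mono : ∀ {x y u v} → x ≤ y → u ≤ v → x ⨾ u ≤ y ⨾ v
  ⨾-mono x≤y u≤v = ≤-trans (⨾-monoˡ _ x≤y) (⨾-monoʳ _ u≤v)

  1'˘≈1' : 1' ˘ ≈ 1'
  1'˘≈1' = begin
    1' ˘                  ≈⟨ ⨾-identityʳ _ ⟨
    1' ˘ ⨾ 1'             ≈⟨ ⨾-cong refl (˘-involutive 1') ⟨
    1' ˘ ⨾ (1' ˘) ˘       ≈⟨ ˘-anti-⨾ (1' ˘) 1' ⟨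
    (1' ˘ ⨾ 1') ˘         ≈⟨ ˘-cong (⨾-identityʳ _) ⟩
    (1' ˘) ˘              ≈⟨ ˘-involutive 1' ⟩
    1'                    ∎
    where open SetoidReasoning setoid

  ⨾-identityˡ : ∀ x → 1' ⨾ x ≈ x
  ⨾-identityˡ x = begin
    1' ⨾ x              ≈⟨ ⨾≈˘-⨾-˘ 1' x ⟩
    (x ˘ ⨾ 1' ˘) ˘      ≈⟨ ˘-cong (trans (⨾-cong refl 1'˘≈1') (⨾-identityʳ _)) ⟩
    (x ˘) ˘             ≈⟨ ˘-involutive x ⟩
    x                   ∎
    where open SetoidReasoning setoid

  1#˘≈1# : 1# ˘ ≈ 1#
  1#˘≈1# = ≤-antisym (x≤1 _)
    (≤-trans (≤-reflexive (sym (˘-involutive 1#))) (˘-mono (x≤1 _)))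

  0#˘≈0# : 0# ˘ ≈ 0#
  0#˘≈0# = ≤-antisym
    (≤-trans (˘-mono (0≤x _)) (≤-reflexive (˘-involutive 0#))) (0≤x _)

  -- The sum of `x ˘` and `(- x) ˘` is the converse of `1#`, hence `1#`.
  -˘≤˘- : ∀ x → - (x ˘) ≤ (- x) ˘
  -˘≤˘- x = x·-y≈0⇒x≤y (-‿cong
    (trans (+-cong (-‿involutive _) (-‿involutive _))
      (trans (sym (˘-distrib-+ _ _)) (trans (˘-cong (x+-x≈1 x)) 1#˘≈1#))))

  ˘-≤-˘ : ∀ x → (- x) ˘ ≤ - (x ˘)
  ˘-≤-˘ x = ≤-trans (˘-mono (≤-trans (≤-reflexive (-‿cong (sym (˘-involutive x)))) (-˘≤˘- (x ˘))))
                    (≤-reflexive (˘-involutive _))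

  -- Tarski's axiom is the case where `z` is the complement of `x ⨾ y`; any other `z` lies below
  -- that one.
  schröderˡ : ∀ {x y z} → x ⨾ y ≤ - z → x ˘ ⨾ z ≤ - y
  schröderˡ {x} {y} le = ≤-trans (⨾-monoʳ (x ˘) (≤-‿swap le)) (tarski x y)

  schröderʳ : ∀ {x y z} → x ⨾ y ≤ - z → z ⨾ y ˘ ≤ - x
  schröderʳ {x} {y} {z} le = begin
    z ⨾ y ˘                  ≈⟨ ⨾≈˘-⨾-˘ z (y ˘) ⟩
    ((y ˘) ˘ ⨾ z ˘) ˘        ≤⟨ ˘-mono (schröderˡ y˘⨾x˘≤-z˘) ⟩
    (- (x ˘)) ˘              ≤⟨ ˘-≤-˘ (x ˘) ⟩
    - ((x ˘) ˘)              ≈⟨ -‿cong (˘-involutive x) ⟩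
    - x                      ∎
    where
    open PosetReasoning ≤-poset
    y˘⨾x˘≤-z˘ : y ˘ ⨾ x ˘ ≤ - (z ˘)
    y˘⨾x˘≤-z˘ = begin
      y ˘ ⨾ x ˘      ≈⟨ ˘-anti-⨾ x y ⟨
      (x ⨾ y) ˘      ≤⟨ ˘-mono le ⟩
      (- z) ˘        ≤⟨ ˘-≤-˘ z ⟩
      - (z ˘)        ∎

  -- The only use of weak associativity: whatever starts where x starts has the domain of x.
  identity-⨾-1 : ∀ {e x y z w} → e ≤ 1' → x ≤ e ⨾ y → z ≤ x ⨾ w → z ≤ e ⨾ 1#
  identity-⨾-1 {e} {x} {y} {z} {w} e≤1' x≤ z≤ = begin
    z                          ≤⟨ z≤ ⟩
    x ⨾ w                      ≤⟨ ⨾-mono x≤ (x≤1 w) ⟩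
    (e ⨾ y) ⨾ 1#               ≤⟨ ⨾-monoˡ 1# (⨾-mono e≤e·1' (x≤1 y)) ⟩
    ((e · 1') ⨾ 1#) ⨾ 1#       ≈⟨ weakAssoc e ⟩
    (e · 1') ⨾ 1#              ≤⟨ ⨾-monoˡ 1# (x·y≤x e 1') ⟩
    e ⨾ 1#                     ∎
    where
    open PosetReasoning ≤-poset
    e≤e·1' : e ≤ e · 1'
    e≤e·1' = ·-greatest ≤-refl e≤1'

-- Atoms and the cycle law

module AtomLaws (𝔄 : WA c ℓ) where
  open WA 𝔄
  open BooleanLaws 𝔄
  open RelationLaws 𝔄

  Atom : Set (c ⊔ ℓ)
  Atom = Setoid.Carrier (At 𝔄)

  infix 4 _≈ᵃ_
  _≈ᵃ_ : Atom → Atom → Set ℓ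
  _≈ᵃ_ = Setoid._≈_ (At 𝔄)

  ∣_∣ : Atom → Carrier
  ∣ a ∣ = proj₁ a

  atom-≤⊎≤- : ∀ (a : Atom) x → ∣ a ∣ ≤ x ⊎ ∣ a ∣ ≤ - x
  atom-≤⊎≤- (a , _ , minimal) x =
    [ (λ a·x≈0 → inj₂ (x·y≈0⇒x≤-y a·x≈0))
    , (λ a·x≈a → inj₁ (≤-trans (≤-reflexive (sym a·x≈a)) (x·y≤y a x)))
    ]′ (minimal (a · x) (x·y≤x a x))

  atom-≤-by-contradiction : ∀ (a : Atom) {x} → ¬ (∣ a ∣ ≤ - x) → ∣ a ∣ ≤ x
  atom-≤-by-contradiction a {x} ¬a≤-x =
    [ (λ a≤x → a≤x) , (λ a≤-x → contradiction a≤-x ¬a≤-x) ]′ (atom-≤⊎≤- a x)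

  atom-≰- : ∀ (a : Atom) {x} → ∣ a ∣ ≤ x → ¬ (∣ a ∣ ≤ - x)
  atom-≰- (_ , a≉0 , _) a≤x a≤-x = a≉0 (≤-complement⇒≈0 a≤x a≤-x)

  atom-≤⇒≈ : ∀ (a b : Atom) → ∣ a ∣ ≤ ∣ b ∣ → a ≈ᵃ b
  atom-≤⇒≈ (a , a≉0 , _) (b , _ , minimal) a≤b =
    [ (λ a≈0 → contradiction a≈0 a≉0) , (λ a≈b → a≈b) ]′ (minimal a a≤b)

  atom-≤-+ : ∀ (a : Atom) {x y} → ∣ a ∣ ≤ x + y → ∣ a ∣ ≤ x ⊎ ∣ a ∣ ≤ y
  atom-≤-+ a {x} {y} a≤x+y =
    [ inj₁
    , (λ a≤-x → inj₂ (atom-≤-by-contradiction a λ a≤-y →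
        atom-≰- a a≤x+y (≤-‿swap (+-least (≤-‿swap a≤-x) (≤-‿swap a≤-y)))))
    ]′ (atom-≤⊎≤- a x)

  _˘ᵃ : Atom → Atom
  (a , a≉0 , minimal) ˘ᵃ = a ˘ , a˘≉0 , minimal˘
    where
    a˘≉0 : a ˘ ≉ 0#
    a˘≉0 eq = a≉0 (trans (sym (˘-involutive a)) (trans (˘-cong eq) 0#˘≈0#))
    minimal˘ : ∀ y → y ≤ a ˘ → y ≈ 0# ⊎ y ≈ a ˘
    minimal˘ y y≤a˘ = Sum.map
      (λ y˘≈0 → trans (sym (˘-involutive y)) (trans (˘-cong y˘≈0) 0#˘≈0#))
      (λ y˘≈a → trans (sym (˘-involutive y)) (˘-cong y˘≈a))
      (minimal (y ˘) (≤-trans (˘-mono y≤a˘) (≤-reflexive (˘-involutive a))))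

  IsIdentity : Atom → Set ℓ
  IsIdentity a = ∣ a ∣ ≤ 1'

  Composes : Atom → Atom → Atom → Set ℓ
  Composes x y z = ∣ z ∣ ≤ ∣ x ∣ ⨾ ∣ y ∣

  identity-resp : ∀ {x y} → x ≈ᵃ y → IsIdentity x → IsIdentity y
  identity-resp x≈y = ≤-trans (≤-reflexive (sym x≈y))

  composes-resp : ∀ {x x′ y y′ z z′} → x ≈ᵃ x′ → y ≈ᵃ y′ → z ≈ᵃ z′ →
                  Composes x y z → Composes x′ y′ z′
  composes-resp x≈ y≈ z≈ xyz =
    ≤-trans (≤-reflexive (sym z≈)) (≤-trans xyz (≤-reflexive (⨾-cong x≈ y≈)))

  identityˡ⇒≈ : ∀ x y z → IsIdentity x → Composes x y z → z ≈ᵃ y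
  identityˡ⇒≈ x y z x≤1' xyz = atom-≤⇒≈ z y
    (≤-trans xyz (≤-trans (⨾-monoˡ _ x≤1') (≤-reflexive (⨾-identityˡ _))))

  identityʳ⇒≈ : ∀ x y z → IsIdentity y → Composes x y z → z ≈ᵃ x
  identityʳ⇒≈ x y z y≤1' xyz = atom-≤⇒≈ z x
    (≤-trans xyz (≤-trans (⨾-monoʳ _ y≤1') (≤-reflexive (⨾-identityʳ _))))

  schröder-atomˡ : ∀ (y z : Atom) x → ∣ z ∣ ≤ x ⨾ ∣ y ∣ → ∣ y ∣ ≤ x ˘ ⨾ ∣ z ∣
  schröder-atomˡ y z x z≤ = atom-≤-by-contradiction y λ y≤- → atom-≰- z z≤
    (≤-‿swap (≤-trans (⨾-monoˡ _ (≤-reflexive (sym (˘-involutive x)))) (schröderˡ (≤-‿swap y≤-))))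

  schröder-atomʳ : ∀ (x z : Atom) y → ∣ z ∣ ≤ ∣ x ∣ ⨾ y → ∣ x ∣ ≤ ∣ z ∣ ⨾ y ˘
  schröder-atomʳ x z y z≤ = atom-≤-by-contradiction x λ x≤- → atom-≰- z z≤
    (≤-‿swap (≤-trans (⨾-monoʳ _ (≤-reflexive (sym (˘-involutive y)))) (schröderʳ (≤-‿swap x≤-))))

  cycleˡ : ∀ x y z → Composes x y z → Composes (x ˘ᵃ) z y
  cycleˡ x y z = schröder-atomˡ y z ∣ x ∣

  cycleʳ : ∀ x y z → Composes x y z → Composes z (y ˘ᵃ) x
  cycleʳ x y z = schröder-atomʳ x z ∣ y ∣

  cycle˘ : ∀ x y z → Composes x y z → Composes (y ˘ᵃ) (x ˘ᵃ) (z ˘ᵃ)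
  cycle˘ x y z xyz = ≤-trans (˘-mono xyz) (≤-reflexive (˘-anti-⨾ _ _))

-- Splitting compositions into atoms

module AtomicLaws (em : ∀ {p} → ExcludedMiddle p) (𝔄 : WA c ℓ) (atomic : Atomic 𝔄) where
  open WA 𝔄
  open BooleanLaws 𝔄
  open RelationLaws 𝔄
  open AtomLaws 𝔄

  ≤-from-atoms : ∀ {x y} → (∀ (a : Atom) → ∣ a ∣ ≤ x → ∣ a ∣ ≤ y) → x ≤ y
  ≤-from-atoms {x} {y} below with em {P = x · (- y) ≈ 0#}
  ... | yes eq  = x·-y≈0⇒x≤y eq
  ... | no  neq with atomic _ neq
  ...   | a , isAtom , a≤ = contradiction (≤-trans a≤ (x·y≤y x (- y)))
    (atom-≰- (a , isAtom) (below (a , isAtom) (≤-trans a≤ (x·y≤x x (- y)))))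

  -- If `x` missed `∣ z ∣ ⨾ y ˘`, the Schröder rule would put `z` below the complement of `x ⨾ y`.
  -- So the meet contains an atom, and the cycle law shows that it serves.
  splitˡ : ∀ (z : Atom) {x y} → ∣ z ∣ ≤ x ⨾ y → ∃[ a ] ∣ a ∣ ≤ x × ∣ z ∣ ≤ ∣ a ∣ ⨾ y
  splitˡ z {x} {y} z≤x⨾y = a , ≤-trans a≤ (x·y≤x _ _) ,
    ≤-trans (schröder-atomʳ z a (y ˘) (≤-trans a≤ (x·y≤y _ _)))
      (⨾-monoʳ _ (≤-reflexive (˘-involutive y)))
    where
    meets : x · (∣ z ∣ ⨾ y ˘) ≉ 0#
    meets eq = atom-≰- z z≤x⨾y (≤-‿swap (≤-trans
      (⨾-monoʳ _ (≤-reflexive (sym (˘-involutive y))))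
      (schröderʳ (≤-‿swap (x·y≈0⇒x≤-y eq)))))
    below : ∃[ a ] IsAtom 𝔄 a × a ≤ x · (∣ z ∣ ⨾ y ˘)
    below = atomic _ meets
    a : Atom
    a = proj₁ below , proj₁ (proj₂ below)
    a≤ : ∣ a ∣ ≤ x · (∣ z ∣ ⨾ y ˘)
    a≤ = proj₂ (proj₂ below)

  splitʳ : ∀ (z : Atom) {x y} → ∣ z ∣ ≤ x ⨾ y → ∃[ b ] ∣ b ∣ ≤ y × ∣ z ∣ ≤ x ⨾ ∣ b ∣
  splitʳ z {x} {y} z≤x⨾y =
    let b , b≤y˘ , z˘≤ = splitˡ (z ˘ᵃ) (≤-trans (˘-mono z≤x⨾y) (≤-reflexive (˘-anti-⨾ x y))) in
    (b ˘ᵃ) ,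
    ≤-trans (˘-mono b≤y˘) (≤-reflexive (˘-involutive y)) ,
    ≤-trans (≤-reflexive (sym (˘-involutive _)))
      (≤-trans (˘-mono z˘≤)
        (≤-reflexive (trans (˘-anti-⨾ _ _) (⨾-cong (˘-involutive x) refl))))

  split : ∀ (z : Atom) {x y} → ∣ z ∣ ≤ x ⨾ y →
          ∃[ a ] ∃[ b ] ∣ a ∣ ≤ x × ∣ b ∣ ≤ y × Composes a b z
  split z z≤x⨾y =
    let a , a≤x , z≤a⨾y = splitˡ z z≤x⨾y
        b , b≤y , abz   = splitʳ z z≤a⨾y
    in a , b , a≤x , b≤y , abz

-- Triangles as labelled networks on three points

module Networks (em : ∀ {p} → ExcludedMiddle p) (𝔄 : WA c ℓ) (atomic : Atomic 𝔄) where
  open WA 𝔄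
  open BooleanLaws 𝔄
  open RelationLaws 𝔄
  open AtomLaws 𝔄
  open AtomicLaws em 𝔄 atomic

  ˘ᵃ-involutive : ∀ x → (x ˘ᵃ) ˘ᵃ ≈ᵃ x
  ˘ᵃ-involutive x = ˘-involutive ∣ x ∣

  domain : ∀ x → ∃[ e ] IsIdentity e × Composes e x x
  domain x = splitˡ x (≤-reflexive (sym (⨾-identityˡ _)))

  dom : Atom → Atom
  dom x = proj₁ (domain x)

  dom-identity : ∀ x → IsIdentity (dom x)
  dom-identity x = proj₁ (proj₂ (domain x))

  dom-composes : ∀ x → Composes (dom x) x x
  dom-composes x = proj₂ (proj₂ (domain x))

  -- Weak associativity puts `z` below `e ⨾ 1#`. An atom `b` with `z` below `e ⨾ b` can only be `z`,
  -- since `e` is an identity.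
  identity-spreads : ∀ e x w z → IsIdentity e → Composes e x x → Composes x w z →
                     Composes e z z
  identity-spreads e x w z e≤1' exx xwz =
    let b , _ , ebz = splitʳ z (identity-⨾-1 e≤1' exx xwz)
        z≈b : z ≈ᵃ b
        z≈b = identityˡ⇒≈ e b z e≤1' ebz
    in composes-resp {e} {e} {b} {z} {z} {z} refl (sym z≈b) refl ebz

  identity-self : ∀ e x → IsIdentity e → Composes e x x → Composes e e e
  identity-self e x e≤1' exx = identity-spreads e x (x ˘ᵃ) e e≤1' exx (cycleʳ e x x exx)

  -- As `e` lies below `x ⨾ x ˘`, it starts where `x` does and so lies below `e′ ⨾ e`; identities
  -- that compose agree.
  identity-unique : ∀ e e′ x → IsIdentity e → IsIdentity e′ →
                    Composes e x x → Composes e′ x x → e ≈ᵃ e′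
  identity-unique e e′ x e≤1' e′≤1' exx e′xx = identityʳ⇒≈ e′ e e e≤1'
    (identity-spreads e′ x (x ˘ᵃ) e e′≤1' e′xx (cycleʳ e x x exx))

  identity-˘ : ∀ e → IsIdentity e → Composes e e e → e ≈ᵃ e ˘ᵃ
  identity-˘ e e≤1' eee = identityʳ⇒≈ (e ˘ᵃ) e e e≤1' (cycleˡ e e e eee)

  -- In a triangle t the entry t κ labels the edge opposite to the vertex κ.
  edge : Triangle 𝔄 → Fin 3 → Fin 3 → Atom
  edge (s , _) 0F 0F = dom (s 2F)
  edge (s , _) 0F 1F = s 2F
  edge (s , _) 0F 2F = s 1F
  edge (s , _) 1F 0F = s 2F ˘ᵃ
  edge (s , _) 1F 1F = dom (s 0F)
  edge (s , _) 1F 2F = s 0F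
  edge (s , _) 2F 0F = s 1F ˘ᵃ
  edge (s , _) 2F 1F = s 0F ˘ᵃ
  edge (s , _) 2F 2F = dom (s 0F ˘ᵃ)

  edge-identity : ∀ t κ → IsIdentity (edge t κ κ)
  edge-identity (s , _) 0F = dom-identity (s 2F)
  edge-identity (s , _) 1F = dom-identity (s 0F)
  edge-identity (s , _) 2F = dom-identity (s 0F ˘ᵃ)

  triangle-120 : ∀ ((s , _) : Triangle 𝔄) → Composes (s 0F) (s 1F ˘ᵃ) (s 2F ˘ᵃ)
  triangle-120 (s , s₁≤) =
    composes-resp {(s 0F ˘ᵃ) ˘ᵃ} {s 0F} {s 1F ˘ᵃ} {s 1F ˘ᵃ} {s 2F ˘ᵃ} {s 2F ˘ᵃ}
      (˘ᵃ-involutive (s 0F)) refl refl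
      (cycleˡ (s 0F ˘ᵃ) (s 2F ˘ᵃ) (s 1F ˘ᵃ) (cycle˘ (s 2F) (s 0F) (s 1F) s₁≤))

  triangle-201 : ∀ ((s , _) : Triangle 𝔄) → Composes (s 1F ˘ᵃ) (s 2F) (s 0F ˘ᵃ)
  triangle-201 (s , s₁≤) =
    composes-resp {s 1F ˘ᵃ} {s 1F ˘ᵃ} {(s 2F ˘ᵃ) ˘ᵃ} {s 2F} {s 0F ˘ᵃ} {s 0F ˘ᵃ}
      refl (˘ᵃ-involutive (s 2F)) refl
      (cycle˘ (s 2F ˘ᵃ) (s 1F) (s 0F) (cycleˡ (s 2F) (s 0F) (s 1F) s₁≤))

  edge-idˡ : ∀ t κ ν → Composes (edge t κ κ) (edge t κ ν) (edge t κ ν)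
  edge-idˡ (s , _)    0F 0F = identity-self (dom (s 2F)) (s 2F) (dom-identity (s 2F)) (dom-composes (s 2F))
  edge-idˡ (s , _)    0F 1F = dom-composes (s 2F)
  edge-idˡ (s , s₁≤)  0F 2F = identity-spreads (dom (s 2F)) (s 2F) (s 0F) (s 1F)
    (dom-identity (s 2F)) (dom-composes (s 2F)) s₁≤
  edge-idˡ t@(s , _)  1F 0F = identity-spreads (dom (s 0F)) (s 0F) (s 1F ˘ᵃ) (s 2F ˘ᵃ)
    (dom-identity (s 0F)) (dom-composes (s 0F)) (triangle-120 t)
  edge-idˡ (s , _)    1F 1F = identity-self (dom (s 0F)) (s 0F) (dom-identity (s 0F)) (dom-composes (s 0F))
  edge-idˡ (s , _)    1F 2F = dom-composes (s 0F)
  edge-idˡ (s , s₁≤)  2F 0F = identity-spreads (dom (s 0F ˘ᵃ)) (s 0F ˘ᵃ) (s 2F ˘ᵃ) (s 1F ˘ᵃ)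
    (dom-identity (s 0F ˘ᵃ)) (dom-composes (s 0F ˘ᵃ)) (cycle˘ (s 2F) (s 0F) (s 1F) s₁≤)
  edge-idˡ (s , _)    2F 1F = dom-composes (s 0F ˘ᵃ)
  edge-idˡ (s , _)    2F 2F = identity-self (dom (s 0F ˘ᵃ)) (s 0F ˘ᵃ)
    (dom-identity (s 0F ˘ᵃ)) (dom-composes (s 0F ˘ᵃ))

  edge-˘ : ∀ t κ ν → edge t κ ν ˘ᵃ ≈ᵃ edge t ν κ
  edge-˘ t       0F 0F = sym (identity-˘ (edge t 0F 0F) (edge-identity t 0F) (edge-idˡ t 0F 0F))
  edge-˘ t       0F 1F = refl
  edge-˘ t       0F 2F = refl
  edge-˘ (s , _) 1F 0F = ˘ᵃ-involutive (s 2F)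
  edge-˘ t       1F 1F = sym (identity-˘ (edge t 1F 1F) (edge-identity t 1F) (edge-idˡ t 1F 1F))
  edge-˘ t       1F 2F = refl
  edge-˘ (s , _) 2F 0F = ˘ᵃ-involutive (s 1F)
  edge-˘ (s , _) 2F 1F = ˘ᵃ-involutive (s 0F)
  edge-˘ t       2F 2F = sym (identity-˘ (edge t 2F 2F) (edge-identity t 2F) (edge-idˡ t 2F 2F))

  edge-idʳ : ∀ t κ ν → Composes (edge t κ ν) (edge t ν ν) (edge t κ ν)
  edge-idʳ t κ ν = composes-resp
    {edge t ν κ ˘ᵃ} {edge t κ ν} {edge t ν ν ˘ᵃ} {edge t ν ν} {edge t ν κ ˘ᵃ} {edge t κ ν}
    (edge-˘ t ν κ) (edge-˘ t ν ν) (edge-˘ t ν κ)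
    (cycle˘ (edge t ν ν) (edge t ν κ) (edge t ν κ) (edge-idˡ t ν κ))

  edge-loop : ∀ t κ ν → Composes (edge t κ ν) (edge t ν κ) (edge t κ κ)
  edge-loop t κ ν = composes-resp
    {edge t κ ν} {edge t κ ν} {edge t κ ν ˘ᵃ} {edge t ν κ} {edge t κ κ} {edge t κ κ}
    refl (edge-˘ t κ ν) refl
    (cycleʳ (edge t κ κ) (edge t κ ν) (edge t κ ν) (edge-idˡ t κ ν))

  -- The six cases with distinct vertices are the Peirce transforms of the one inequality that
  -- defines a triangle. The others involve a loop and rest on `edge-idˡ`.
  edge-composes : ∀ t κ ν ρ → Composes (edge t κ ν) (edge t ν ρ) (edge t κ ρ)
  edge-composes t         0F 0F ρ  = edge-idˡ t 0F ρ
  edge-composes t         1F 1F ρ  = edge-idˡ t 1F ρ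
  edge-composes t         2F 2F ρ  = edge-idˡ t 2F ρ
  edge-composes t         0F 1F 0F = edge-loop t 0F 1F
  edge-composes t         0F 1F 1F = edge-idʳ t 0F 1F
  edge-composes (s , s₁≤) 0F 1F 2F = s₁≤
  edge-composes t         0F 2F 0F = edge-loop t 0F 2F
  edge-composes (s , s₁≤) 0F 2F 1F = cycleʳ (s 2F) (s 0F) (s 1F) s₁≤
  edge-composes t         0F 2F 2F = edge-idʳ t 0F 2F
  edge-composes t         1F 0F 0F = edge-idʳ t 1F 0F
  edge-composes t         1F 0F 1F = edge-loop t 1F 0F
  edge-composes (s , s₁≤) 1F 0F 2F = cycleˡ (s 2F) (s 0F) (s 1F) s₁≤
  edge-composes t         1F 2F 0F = triangle-120 t
  edge-composes t         1F 2F 1F = edge-loop t 1F 2F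
  edge-composes t         1F 2F 2F = edge-idʳ t 1F 2F
  edge-composes t         2F 0F 0F = edge-idʳ t 2F 0F
  edge-composes t         2F 0F 1F = triangle-201 t
  edge-composes t         2F 0F 2F = edge-loop t 2F 0F
  edge-composes (s , s₁≤) 2F 1F 0F = cycle˘ (s 2F) (s 0F) (s 1F) s₁≤
  edge-composes t         2F 1F 1F = edge-idʳ t 2F 1F
  edge-composes t         2F 1F 2F = edge-loop t 2F 1F

  -- A loop is computed from one chosen side, but only one identity composes with any given side at
  -- that vertex; so every side determines the loops at its ends.
  edge-diagonal : ∀ t t′ κ ν → edge t κ ν ≈ᵃ edge t′ κ ν → edge t κ κ ≈ᵃ edge t′ κ κ
  edge-diagonal t t′ κ ν eq =
    identity-unique (edge t κ κ) (edge t′ κ κ) (edge t′ κ ν)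
      (edge-identity t κ) (edge-identity t′ κ)
      (composes-resp {edge t κ κ} {edge t κ κ} {edge t κ ν} {edge t′ κ ν} {edge t κ ν} {edge t′ κ ν}
        refl eq eq (edge-idˡ t κ ν))
      (edge-idˡ t′ κ ν)

  -- A step at `κ` moves only that vertex: the opposite side survives together with the loops at its
  -- ends. This carries labels across steps.
  edge-shared : ∀ t t′ κ ν ρ → ν ≢ κ → ρ ≢ κ → _⟨_⟩ 𝔄 t κ ≈ _⟨_⟩ 𝔄 t′ κ →
                edge t ν ρ ≈ᵃ edge t′ ν ρ
  edge-shared t t′ 0F 0F _  ν≢ ρ≢ eq = contradiction ≡.refl ν≢
  edge-shared t t′ 0F _  0F ν≢ ρ≢ eq = contradiction ≡.refl ρ≢
  edge-shared t t′ 0F 1F 1F ν≢ ρ≢ eq = edge-diagonal t t′ 1F 2F eq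
  edge-shared t t′ 0F 1F 2F ν≢ ρ≢ eq = eq
  edge-shared t t′ 0F 2F 1F ν≢ ρ≢ eq = ˘-cong eq
  edge-shared t t′ 0F 2F 2F ν≢ ρ≢ eq = edge-diagonal t t′ 2F 1F (˘-cong eq)
  edge-shared t t′ 1F 1F _  ν≢ ρ≢ eq = contradiction ≡.refl ν≢
  edge-shared t t′ 1F _  1F ν≢ ρ≢ eq = contradiction ≡.refl ρ≢
  edge-shared t t′ 1F 0F 0F ν≢ ρ≢ eq = edge-diagonal t t′ 0F 2F eq
  edge-shared t t′ 1F 0F 2F ν≢ ρ≢ eq = eq
  edge-shared t t′ 1F 2F 0F ν≢ ρ≢ eq = ˘-cong eq
  edge-shared t t′ 1F 2F 2F ν≢ ρ≢ eq = edge-diagonal t t′ 2F 0F (˘-cong eq)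
  edge-shared t t′ 2F 2F _  ν≢ ρ≢ eq = contradiction ≡.refl ν≢
  edge-shared t t′ 2F _  2F ν≢ ρ≢ eq = contradiction ≡.refl ρ≢
  edge-shared t t′ 2F 0F 0F ν≢ ρ≢ eq = edge-diagonal t t′ 0F 1F eq
  edge-shared t t′ 2F 0F 1F ν≢ ρ≢ eq = eq
  edge-shared t t′ 2F 1F 0F ν≢ ρ≢ eq = ˘-cong eq
  edge-shared t t′ 2F 1F 1F ν≢ ρ≢ eq = edge-diagonal t t′ 1F 0F (˘-cong eq)

  edge-cong : ∀ t t′ ν ρ → (∀ κ → _⟨_⟩ 𝔄 t κ ≈ _⟨_⟩ 𝔄 t′ κ) → edge t ν ρ ≈ᵃ edge t′ ν ρ
  edge-cong t t′ 0F 0F eq = edge-shared t t′ 2F 0F 0F (λ ()) (λ ()) (eq 2F)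
  edge-cong t t′ 0F 1F eq = eq 2F
  edge-cong t t′ 0F 2F eq = eq 1F
  edge-cong t t′ 1F 0F eq = ˘-cong (eq 2F)
  edge-cong t t′ 1F 1F eq = edge-shared t t′ 2F 1F 1F (λ ()) (λ ()) (eq 2F)
  edge-cong t t′ 1F 2F eq = eq 0F
  edge-cong t t′ 2F 0F eq = ˘-cong (eq 1F)
  edge-cong t t′ 2F 1F eq = ˘-cong (eq 0F)
  edge-cong t t′ 2F 2F eq = edge-shared t t′ 1F 2F 2F (λ ()) (λ ()) (eq 1F)

-- Partial labellings seen from a fixed point

module Labellings (em : ∀ {p} → ExcludedMiddle p) (𝔄 : WA c ℓ) (atomic : Atomic 𝔄) where
  open WA 𝔄
  open AtomLaws 𝔄
  open Networks em 𝔄 atomic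

  edge-collapseˡ : ∀ t ν ρ σ → IsIdentity (edge t ν ρ) → edge t ν σ ≈ᵃ edge t ρ σ
  edge-collapseˡ t ν ρ σ νρ≤1' =
    identityˡ⇒≈ (edge t ν ρ) (edge t ρ σ) (edge t ν σ) νρ≤1' (edge-composes t ν ρ σ)

  edge-collapseʳ : ∀ t ν ρ σ → IsIdentity (edge t ν ρ) → edge t σ ρ ≈ᵃ edge t σ ν
  edge-collapseʳ t ν ρ σ νρ≤1' =
    identityʳ⇒≈ (edge t σ ν) (edge t ν ρ) (edge t σ ρ) νρ≤1' (edge-composes t σ ν ρ)

  edge-identity-sym : ∀ t ν ρ → IsIdentity (edge t ν ρ) → IsIdentity (edge t ρ ν)
  edge-identity-sym t ν ρ νρ≤1' =
    identity-resp {edge t ν ν} {edge t ρ ν} (edge-collapseˡ t ν ρ ν νρ≤1') (edge-identity t ν)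

  -- Composition of atoms becomes single-valued as soon as one factor is an identity.
  collapse-unique : ∀ x y z w → IsIdentity x ⊎ IsIdentity y →
                    Composes x y z → Composes x y w → z ≈ᵃ w
  collapse-unique x y z w (inj₁ x≤1') xyz xyw =
    trans (identityˡ⇒≈ x y z x≤1' xyz) (sym (identityˡ⇒≈ x y w x≤1' xyw))
  collapse-unique x y z w (inj₂ y≤1') xyz xyw =
    trans (identityʳ⇒≈ x y z y≤1' xyz) (sym (identityʳ⇒≈ x y w y≤1' xyw))

  opposite-identity : ∀ t κ ν μ → κ ≢ ν → μ ≢ κ → μ ≢ ν → _⟨_⟩ 𝔄 t μ ≤ 1' →
                      IsIdentity (edge t κ ν)
  opposite-identity t 0F 0F _  κ≢ν _ _ _ = contradiction ≡.refl κ≢ν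
  opposite-identity t 1F 1F _  κ≢ν _ _ _ = contradiction ≡.refl κ≢ν
  opposite-identity t 2F 2F _  κ≢ν _ _ _ = contradiction ≡.refl κ≢ν
  opposite-identity t 0F 1F 2F _ _ _ le = le
  opposite-identity t 0F 2F 1F _ _ _ le = le
  opposite-identity t 1F 2F 0F _ _ _ le = le
  opposite-identity t 1F 0F 2F _ _ _ le = edge-identity-sym t 0F 1F le
  opposite-identity t 2F 0F 1F _ _ _ le = edge-identity-sym t 0F 2F le
  opposite-identity t 2F 1F 0F _ _ _ le = edge-identity-sym t 1F 2F le
  opposite-identity t 0F _  0F _ μ≢κ _ _ = contradiction ≡.refl μ≢κ
  opposite-identity t 1F _  1F _ μ≢κ _ _ = contradiction ≡.refl μ≢κ
  opposite-identity t 2F _  2F _ μ≢κ _ _ = contradiction ≡.refl μ≢κ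
  opposite-identity t _  0F 0F _ _ μ≢ν _ = contradiction ≡.refl μ≢ν
  opposite-identity t _  1F 1F _ _ μ≢ν _ = contradiction ≡.refl μ≢ν
  opposite-identity t _  2F 2F _ _ μ≢ν _ = contradiction ≡.refl μ≢ν

  Labelling : Set (suc (c ⊔ ℓ))
  Labelling = Fin 3 → Atom → Set (c ⊔ ℓ)

  -- L ν x says that the edge from a fixed point to the vertex ν of t is labelled x; a vertex
  -- not adjacent to the fixed point carries no label.
  record Coherent (L : Labelling) (t : Triangle 𝔄) : Set (c ⊔ ℓ) where
    field
      resp       : ∀ ν x y → x ≈ᵃ y → L ν x → L ν y
      composes   : ∀ ν ρ x y → L ν x → L ρ y → Composes x (edge t ν ρ) y
      atIdentity : ∀ ν ρ x → L ν x → IsIdentity x → L ρ (edge t ν ρ)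
      glued      : ∀ ν ρ x → L ν x → IsIdentity (edge t ν ρ) → L ρ x

    unique : ∀ ν x y → L ν x → L ν y → x ≈ᵃ y
    unique ν x y Lx Ly =
      sym (identityʳ⇒≈ x (edge t ν ν) y (edge-identity t ν) (composes ν ν x y Lx Ly))

  coherent-cong : ∀ L t t′ → (∀ κ → _⟨_⟩ 𝔄 t κ ≈ _⟨_⟩ 𝔄 t′ κ) → Coherent L t → Coherent L t′
  coherent-cong L t t′ t≈t′ coh = record
    { resp       = resp
    ; composes   = λ ν ρ x y Lx Ly →
        composes-resp {x} {x} {edge t ν ρ} {edge t′ ν ρ} {y} {y}
          refl (edge-cong t t′ ν ρ t≈t′) refl (composes ν ρ x y Lx Ly)
    ; atIdentity = λ ν ρ x Lx x≤1' →
        resp ρ (edge t ν ρ) (edge t′ ν ρ) (edge-cong t t′ ν ρ t≈t′) (atIdentity ν ρ x Lx x≤1')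
    ; glued      = λ ν ρ x Lx νρ≤1' →
        glued ν ρ x Lx (identity-resp {edge t′ ν ρ} {edge t ν ρ} (sym (edge-cong t t′ ν ρ t≈t′)) νρ≤1')
    }
    where open Coherent coh

  -- The fixed point is the vertex 0 of `t₀`. A trail that starts at another triangle lies in
  -- another tree, and its vertices get no labels.
  data Initial (t₀ t : Triangle 𝔄) (ν : Fin 3) (x : Atom) : Set (c ⊔ ℓ) where
    initial : (∀ κ → _⟨_⟩ 𝔄 t κ ≈ _⟨_⟩ 𝔄 t₀ κ) → x ≈ᵃ edge t 0F ν → Initial t₀ t ν x

  initial-coherent : ∀ t₀ t → Coherent (Initial t₀ t) t
  initial-coherent t₀ t = record
    { resp       = λ { ν x y x≈y (initial t≈t₀ x≈) → initial t≈t₀ (trans (sym x≈y) x≈) }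
    ; composes   = λ { ν ρ x y (initial _ x≈) (initial _ y≈) →
        composes-resp {edge t 0F ν} {x} {edge t ν ρ} {edge t ν ρ} {edge t 0F ρ} {y}
          (sym x≈) refl (sym y≈) (edge-composes t 0F ν ρ) }
    ; atIdentity = λ { ν ρ x (initial t≈t₀ x≈) x≤1' → initial t≈t₀
        (sym (edge-collapseˡ t 0F ν ρ (identity-resp {x} {edge t 0F ν} x≈ x≤1'))) }
    ; glued      = λ { ν ρ x (initial t≈t₀ x≈) νρ≤1' → initial t≈t₀
        (trans x≈ (sym (edge-collapseʳ t ν ρ 0F νρ≤1'))) }
    }

  -- Across a step at κ the new vertex κ gets a label only from a kept vertex ρ with which
  -- either the fixed point or κ itself coincides.
  data Extend (L : Labelling) (t : Triangle 𝔄) (κ : Fin 3) : Labelling where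
    keep  : ∀ {ν x} → ν ≢ κ → L ν x → Extend L t κ ν x
    fresh : ∀ {x} ρ z → ρ ≢ κ → L ρ z → IsIdentity z ⊎ IsIdentity (edge t ρ κ) →
            Composes z (edge t ρ κ) x → Extend L t κ κ x

  module _ {L : Labelling} {t′ t : Triangle 𝔄} {κ : Fin 3}
           (t′≈t : _⟨_⟩ 𝔄 t′ κ ≈ _⟨_⟩ 𝔄 t κ) (coh : Coherent L t′) where
    private
      module Old = Coherent coh

      old-composes : ∀ ν ρ x y → ν ≢ κ → ρ ≢ κ → L ν x → L ρ y → Composes x (edge t ν ρ) y
      old-composes ν ρ x y ν≢κ ρ≢κ Lx Ly =
        composes-resp {x} {x} {edge t′ ν ρ} {edge t ν ρ} {y} {y}
          refl (edge-shared t′ t κ ν ρ ν≢κ ρ≢κ t′≈t) refl (Old.composes ν ρ x y Lx Ly)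

      old-atIdentity : ∀ ν ρ x → ν ≢ κ → ρ ≢ κ → L ν x → IsIdentity x → L ρ (edge t ν ρ)
      old-atIdentity ν ρ x ν≢κ ρ≢κ Lx x≤1' =
        Old.resp ρ (edge t′ ν ρ) (edge t ν ρ) (edge-shared t′ t κ ν ρ ν≢κ ρ≢κ t′≈t)
          (Old.atIdentity ν ρ x Lx x≤1')

      old-glued : ∀ ν ρ x → ν ≢ κ → ρ ≢ κ → L ν x → IsIdentity (edge t ν ρ) → L ρ x
      old-glued ν ρ x ν≢κ ρ≢κ Lx νρ≤1' =
        Old.glued ν ρ x Lx (identity-resp {edge t ν ρ} {edge t′ ν ρ}
          (sym (edge-shared t′ t κ ν ρ ν≢κ ρ≢κ t′≈t)) νρ≤1')

      -- If the fixed point coincides with `ρ`, then `x` and `y` are sides of `t` and the claim is a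
      -- triangle law of `t`. If `κ` coincides with `ρ`, then `y` is `z` and the claim is the old
      -- coherence.
      keep-fresh : ∀ ν x ρ z y → ν ≢ κ → L ν x → ρ ≢ κ → L ρ z →
                   IsIdentity z ⊎ IsIdentity (edge t ρ κ) → Composes z (edge t ρ κ) y →
                   Composes x (edge t ν κ) y
      keep-fresh ν x ρ z y ν≢κ Lx ρ≢κ Lz (inj₁ z≤1') zρκy =
        composes-resp {edge t ρ ν} {x} {edge t ν κ} {edge t ν κ} {edge t ρ κ} {y}
          (sym (identityˡ⇒≈ z (edge t ρ ν) x z≤1' (old-composes ρ ν z x ρ≢κ ν≢κ Lz Lx)))
          refl
          (sym (identityˡ⇒≈ z (edge t ρ κ) y z≤1' zρκy))
          (edge-composes t ρ ν κ)
      keep-fresh ν x ρ z y ν≢κ Lx ρ≢κ Lz (inj₂ ρκ≤1') zρκy =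
        composes-resp {x} {x} {edge t ν ρ} {edge t ν κ} {z} {y}
          refl
          (sym (edge-collapseʳ t ρ κ ν ρκ≤1'))
          (sym (identityʳ⇒≈ z (edge t ρ κ) y ρκ≤1' zρκy))
          (old-composes ν ρ x z ν≢κ ρ≢κ Lx Lz)

      fresh-composes-κ : ∀ ρ z x → IsIdentity z ⊎ IsIdentity (edge t ρ κ) →
                         Composes z (edge t ρ κ) x → Composes x (edge t κ κ) x
      fresh-composes-κ ρ z x (inj₁ z≤1') zρκx =
        let x≈ = sym (identityˡ⇒≈ z (edge t ρ κ) x z≤1' zρκx) in
        composes-resp {edge t ρ κ} {x} {edge t κ κ} {edge t κ κ} {edge t ρ κ} {x}
          x≈ refl x≈ (edge-composes t ρ κ κ)
      fresh-composes-κ ρ z x (inj₂ ρκ≤1') zρκx =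
        composes-resp {z} {x} {edge t ρ κ} {edge t κ κ} {x} {x}
          (sym (identityʳ⇒≈ z (edge t ρ κ) x ρκ≤1' zρκx))
          (edge-collapseˡ t ρ κ κ ρκ≤1') refl zρκx

      composes-sym : ∀ x ν ρ y → Composes x (edge t ν ρ) y → Composes y (edge t ρ ν) x
      composes-sym x ν ρ y xνρy =
        composes-resp {y} {y} {edge t ν ρ ˘ᵃ} {edge t ρ ν} {x} {x}
          refl (edge-˘ t ν ρ) refl (cycleʳ x (edge t ν ρ) y xνρy)

      ext-composes : ∀ ν ρ x y → Extend L t κ ν x → Extend L t κ ρ y → Composes x (edge t ν ρ) y
      ext-composes ν ρ x y (keep ν≢κ Lx) (keep ρ≢κ Ly) = old-composes ν ρ x y ν≢κ ρ≢κ Lx Ly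
      ext-composes ν _ x y (keep ν≢κ Lx) (fresh σ z σ≢κ Lz z⊎σκ zσκy) =
        keep-fresh ν x σ z y ν≢κ Lx σ≢κ Lz z⊎σκ zσκy
      ext-composes _ ρ x y (fresh σ z σ≢κ Lz z⊎σκ zσκx) (keep ρ≢κ Ly) =
        composes-sym y ρ κ x (keep-fresh ρ y σ z x ρ≢κ Ly σ≢κ Lz z⊎σκ zσκx)
      -- Both labels are composites of `w` with `edge t τ κ`, and there is only one such composite;
      -- so `y` is `x`, and the loop at `κ` suffices.
      ext-composes _ _ x y (fresh σ z σ≢κ Lz z⊎σκ zσκx) (fresh τ w τ≢κ Lw w⊎τκ wτκy) =
        composes-resp {x} {x} {edge t κ κ} {edge t κ κ} {x} {y} refl refl
          (collapse-unique w (edge t τ κ) x y w⊎τκ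
            (keep-fresh τ w σ z x τ≢κ Lw σ≢κ Lz z⊎σκ zσκx) wτκy)
          (fresh-composes-κ σ z x z⊎σκ zσκx)

      ext-resp : ∀ ν x y → x ≈ᵃ y → Extend L t κ ν x → Extend L t κ ν y
      ext-resp ν x y x≈y (keep ν≢κ Lx) = keep ν≢κ (Old.resp ν x y x≈y Lx)
      ext-resp _ x y x≈y (fresh σ z σ≢κ Lz z⊎σκ zσκx) = fresh σ z σ≢κ Lz z⊎σκ
        (composes-resp {z} {z} {edge t σ κ} {edge t σ κ} {x} {y} refl refl x≈y zσκx)

      fresh-identities : ∀ ρ z x → IsIdentity z ⊎ IsIdentity (edge t ρ κ) →
                         Composes z (edge t ρ κ) x → IsIdentity x →
                         IsIdentity z × IsIdentity (edge t ρ κ)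
      fresh-identities ρ z x (inj₁ z≤1') zρκx x≤1' =
        z≤1' , identity-resp {x} {edge t ρ κ} (identityˡ⇒≈ z (edge t ρ κ) x z≤1' zρκx) x≤1'
      fresh-identities ρ z x (inj₂ ρκ≤1') zρκx x≤1' =
        identity-resp {x} {z} (identityʳ⇒≈ z (edge t ρ κ) x ρκ≤1' zρκx) x≤1' , ρκ≤1'

      ext-atIdentity : ∀ ν ρ x → Extend L t κ ν x → IsIdentity x → Extend L t κ ρ (edge t ν ρ)
      ext-atIdentity ν ρ x (keep ν≢κ Lx) x≤1' with ρ ≟ κ
      ... | no ρ≢κ     = keep ρ≢κ (old-atIdentity ν ρ x ν≢κ ρ≢κ Lx x≤1')
      -- The identity labelling `ν` is traded for the loop at `ν`, whose composite with the side
      -- from `ν` to `κ` is known from the triangle.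
      ... | yes ≡.refl = fresh ν (edge t ν ν) ν≢κ (old-atIdentity ν ν x ν≢κ ν≢κ Lx x≤1')
        (inj₁ (edge-identity t ν)) (edge-composes t ν ν κ)
      ext-atIdentity _ ρ x (fresh σ z σ≢κ Lz z⊎σκ zσκx) x≤1' with ρ ≟ κ
      ... | yes ≡.refl = ext-resp κ x (edge t κ κ)
        (identityˡ⇒≈ x (edge t κ κ) x x≤1' (fresh-composes-κ σ z x z⊎σκ zσκx))
        (fresh σ z σ≢κ Lz z⊎σκ zσκx)
      ... | no ρ≢κ     =
        let z≤1' , σκ≤1' = fresh-identities σ z x z⊎σκ zσκx x≤1' in
        keep ρ≢κ (Old.resp ρ (edge t σ ρ) (edge t κ ρ) (edge-collapseˡ t σ κ ρ σκ≤1')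
          (old-atIdentity σ ρ z σ≢κ ρ≢κ Lz z≤1'))

      ext-glued : ∀ ν ρ x → Extend L t κ ν x → IsIdentity (edge t ν ρ) → Extend L t κ ρ x
      ext-glued ν ρ x (keep ν≢κ Lx) νρ≤1' with ρ ≟ κ
      ... | no ρ≢κ     = keep ρ≢κ (old-glued ν ρ x ν≢κ ρ≢κ Lx νρ≤1')
      ... | yes ≡.refl = fresh ν x ν≢κ Lx (inj₂ νρ≤1')
        (composes-resp {x} {x} {edge t ν ν} {edge t ν κ} {x} {x}
          refl (sym (edge-collapseʳ t ν κ ν νρ≤1')) refl (old-composes ν ν x x ν≢κ ν≢κ Lx Lx))
      ext-glued _ ρ x e@(fresh σ z σ≢κ Lz z⊎σκ zσκx) κρ≤1' with ρ ≟ κ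
      ... | yes ≡.refl = e
      ... | no ρ≢κ     = keep ρ≢κ (fresh-kept z⊎σκ)
        where
        fresh-kept : IsIdentity z ⊎ IsIdentity (edge t σ κ) → L ρ x
        fresh-kept (inj₁ z≤1') = Old.resp ρ (edge t σ ρ) x
          (trans (edge-collapseʳ t κ ρ σ κρ≤1') (sym (identityˡ⇒≈ z (edge t σ κ) x z≤1' zσκx)))
          (old-atIdentity σ ρ z σ≢κ ρ≢κ Lz z≤1')
        fresh-kept (inj₂ σκ≤1') = Old.resp ρ z x
          (sym (identityʳ⇒≈ z (edge t σ κ) x σκ≤1' zσκx))
          (old-glued σ ρ z σ≢κ ρ≢κ Lz
            (identity-resp {edge t κ ρ} {edge t σ ρ} (sym (edge-collapseˡ t σ κ ρ σκ≤1')) κρ≤1'))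

    extend-coherent : Coherent (Extend L t κ) t
    extend-coherent = record
      { resp       = ext-resp
      ; composes   = ext-composes
      ; atIdentity = ext-atIdentity
      ; glued      = ext-glued
      }

  extend-cong : ∀ {L L′ : Labelling} {t t′ κ} → (∀ κ → _⟨_⟩ 𝔄 t κ ≈ _⟨_⟩ 𝔄 t′ κ) →
                (∀ {ν x} → L ν x → L′ ν x) → ∀ {ν x} → Extend L t κ ν x → Extend L′ t′ κ ν x
  extend-cong t≈t′ f (keep ν≢κ Lx) = keep ν≢κ (f Lx)
  extend-cong {t = t} {t′} {κ} t≈t′ f (fresh {x} σ z σ≢κ Lz z⊎σκ zσκx) =
    fresh σ z σ≢κ (f Lz)
      (Sum.map₂ (identity-resp {edge t σ κ} {edge t′ σ κ} (edge-cong t t′ σ κ t≈t′)) z⊎σκ)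
      (composes-resp {z} {z} {edge t σ κ} {edge t′ σ κ} {x} {x} refl (edge-cong t t′ σ κ t≈t′) refl zσκx)

-- Trails up to equality of triangles

module TrailEquality (𝔄 : WA c ℓ) where
  open Trails (suitableStructure 𝔄)
  private
    module B = Setoid (Structure.B (suitableStructure 𝔄))

  infix 4 _≋_
  _≋_ : List Step → List Step → Set (c ⊔ ℓ)
  _≋_ = Pointwise (λ x y → proj₁ x B.≈ proj₁ y × proj₂ x ≡ proj₂ y)

  ≋-refl : ∀ {xs} → xs ≋ xs
  ≋-refl {[]}           = []
  ≋-refl {(t , _) ∷ xs} = (B.refl {t} , ≡.refl) ∷ ≋-refl

  infix 4 _≈ᵤ_
  _≈ᵤ_ : Trail → Trail → Set (c ⊔ ℓ)
  _≈ᵤ_ = Setoid._≈_ U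

  ⟶⇒≈ : ∀ {p q} → steps p ⟶ steps q → p ≈ᵤ q
  ⟶⇒≈ {p} {q} = return {x = p} {q}

  ≡⇒⟶ : ∀ {xs ys} → xs ≡ ys → xs ⟶ ys
  ≡⇒⟶ ≡.refl = same ≋-refl

  ≡⇒≈ : ∀ {p q} → steps p ≡ steps q → p ≈ᵤ q
  ≡⇒≈ {p} {q} eq = ⟶⇒≈ {p} {q} (≡⇒⟶ eq)

  single : Triangle 𝔄 → Trail
  single t = trail [] t 0F [-]

-- Reduced trails and the labels they produce

module Stacks (em : ∀ {p} → ExcludedMiddle p) (𝔄 : WA c ℓ) (atomic : Atomic 𝔄)
              (t₀ : Triangle 𝔄) where
  open WA 𝔄
  open AtomLaws 𝔄
  open Networks em 𝔄 atomic
  open Labellings em 𝔄 atomic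
  open TrailEquality 𝔄
  open Trails (suitableStructure 𝔄)
  private
    module B = Setoid (Structure.B (suitableStructure 𝔄))

  -- The reduced form of a trail, its last triangle on top; the label of a frame is the vertex
  -- changed by the step onto it (the label of the bottom frame is irrelevant).
  data Stack : Set (c ⊔ ℓ) where
    ∅    : Stack
    push : Stack → Fin 3 → Triangle 𝔄 → Stack

  infix 4 _∼_
  data _∼_ : Stack → Stack → Set (c ⊔ ℓ) where
    ∅    : ∅ ∼ ∅
    push : ∀ {s s′ κ t t′} → s ∼ s′ → t B.≈ t′ → push s κ t ∼ push s′ κ t′

  ∼-refl : ∀ {s} → s ∼ s
  ∼-refl {∅}          = ∅
  ∼-refl {push s κ t} = push ∼-refl (B.refl {t})

  ∼-sym : ∀ {s s′} → s ∼ s′ → s′ ∼ s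
  ∼-sym ∅                        = ∅
  ∼-sym (push {t = t} {t′} p eq) = push (∼-sym p) (B.sym {t} {t′} eq)

  labels : Stack → Labelling
  labels ∅                       = λ _ _ → ⊥
  labels (push ∅ κ t)            = Initial t₀ t
  labels (push s@(push _ _ _) κ t) = Extend (labels s) t κ

  labels-cong : ∀ {s s′} → s ∼ s′ → ∀ {ν x} → labels s ν x → labels s′ ν x
  labels-cong (push {t = t} {t′} ∅ t≈t′) {ν} (initial t≈t₀ x≈) =
    initial (B.trans {t′} {t} {t₀} (B.sym {t} {t′} t≈t′) t≈t₀) (trans x≈ (edge-cong t t′ 0F ν t≈t′))
  labels-cong (push {t = t} {t′} p@(push _ _) t≈t′) =
    extend-cong {t = t} {t′} t≈t′ (labels-cong p)

  Fits : Stack → Fin 3 → Triangle 𝔄 → Set ℓ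
  Fits ∅            κ t = ⊤
  Fits (push _ _ u) κ t = Structure.T (suitableStructure 𝔄) κ u t

  -- The vertices are compared as well as the triangles, because backtracking cancels only two steps
  -- made at the same vertex. The bottom frame is never popped.
  Returns : Stack → Fin 3 → Triangle 𝔄 → Set ℓ
  Returns (push (push _ _ u) ι _) κ t = ι ≡ κ × u B.≈ t
  Returns _                       κ t = ⊥

  Valid : Stack → Set ℓ
  Valid ∅            = ⊤
  Valid (push s κ t) = Valid s × Fits s κ t × ¬ Returns s κ t

  HasTop : Stack → Triangle 𝔄 → Set ℓ
  HasTop ∅            t = ⊥
  HasTop (push _ _ u) t = u B.≈ t

  pop : Stack → Stack
  pop ∅            = ∅
  pop (push s _ _) = s

  move′ : ∀ s κ t → Dec (Returns s κ t) → Stack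
  move′ s κ t (yes _) = pop s
  move′ s κ t (no _)  = push s κ t

  move : Stack → Fin 3 → Triangle 𝔄 → Stack
  move s κ t = move′ s κ t em

  returns-cong : ∀ {s s′ κ t t′} → s ∼ s′ → t B.≈ t′ → Returns s κ t → Returns s′ κ t′
  returns-cong {t = t} {t′} (push (push {t = u} {u′} _ u≈u′) _) t≈t′ (ι≡κ , u≈t) =
    ι≡κ , B.trans {u′} {u} {t′} (B.sym {u} {u′} u≈u′) (B.trans {u} {t} {t′} u≈t t≈t′)

  pop-cong : ∀ {s s′} → s ∼ s′ → pop s ∼ pop s′
  pop-cong ∅          = ∅
  pop-cong (push p _) = p

  move-cong : ∀ {s s′} κ t t′ → s ∼ s′ → t B.≈ t′ → move s κ t ∼ move s′ κ t′
  move-cong {s} {s′} κ t t′ p t≈t′ = go em em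
    where
    go : ∀ d d′ → move′ s κ t d ∼ move′ s′ κ t′ d′
    go (yes _)  (yes _)  = pop-cong p
    go (yes r)  (no ¬r′) = contradiction (returns-cong p t≈t′ r) ¬r′
    go (no ¬r)  (yes r′) = contradiction (returns-cong (∼-sym p) (B.sym {t} {t′} t≈t′) r′) ¬r
    go (no _)   (no _)   = push p t≈t′

  valid-pop : ∀ s → Valid s → Valid (pop s)
  valid-pop ∅            v       = v
  valid-pop (push s _ _) (v , _) = v

  valid-move : ∀ s κ t → Valid s → Fits s κ t → Valid (move s κ t)
  valid-move s κ t v f = go em
    where
    go : ∀ d → Valid (move′ s κ t d)
    go (yes _) = valid-pop s v
    go (no ¬r) = v , f , ¬r

  hasTop-move : ∀ s κ t → HasTop (move s κ t) t
  hasTop-move s κ t = go s em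
    where
    go : ∀ s d → HasTop (move′ s κ t d) t
    go (push (push _ _ _) _ _) (yes (_ , u≈t)) = u≈t
    go s                       (no _)          = B.refl {t}

  fits-hasTop : ∀ s κ t u → HasTop s t → Structure.T (suitableStructure 𝔄) κ t u → Fits s κ u
  fits-hasTop (push _ _ _) κ t u top t~u = trans (top κ) t~u

  -- A step and its reversal either push and then pop, or pop and then push the same frame again. A
  -- second pop after the first would contradict that the stack is reduced.
  move-move : ∀ s ι t u → Valid s → HasTop s t → move (move s ι u) ι t ∼ s
  move-move s ι t u v top = go s v top em em
    where
    go : ∀ s → Valid s → HasTop s t → ∀ (d : Dec (Returns s ι u)) →
         (d′ : Dec (Returns (move′ s ι u d) ι t)) →
         move′ (move′ s ι u d) ι t d′ ∼ s
    go (push (push s κ _) ι′ w) (v , _ , ¬r) top (yes (≡.refl , _)) (yes r) =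
      contradiction (returns-cong {push s κ _} (∼-refl) (B.sym {w} {t} top) r) ¬r
    go (push (push _ _ _) ι′ w) v top (yes (≡.refl , _)) (no _) = push ∼-refl (B.sym {w} {t} top)
    go (push _ _ _) v top (no _) (yes _) = ∼-refl
    go (push _ _ _) v top (no _) (no ¬r) = contradiction (≡.refl , top) ¬r

  coherent : ∀ s t → Valid s → HasTop s t → Coherent (labels s) t
  coherent (push ∅ κ u) t v u≈t = coherent-cong _ u t u≈t (initial-coherent t₀ u)
  coherent (push s@(push _ _ w) κ u) t (v , f , _) u≈t =
    coherent-cong _ u t u≈t (extend-coherent {t′ = w} {u} {κ} f (coherent s w v (B.refl {w})))

  extend-kept : ∀ {L t κ ν x} → ν ≢ κ → Extend L t κ ν x → L ν x
  extend-kept ν≢κ (keep _ Lx)         = Lx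
  extend-kept ν≢κ (fresh _ _ _ _ _ _) = contradiction ≡.refl ν≢κ

  -- `Extend` touches only the vertex being moved, so the labels of the other two survive a push and
  -- a pop alike.
  move-labels : ∀ s ι t u ν x → HasTop s t → ι ≢ ν →
                (labels (move s ι u) ν x → labels s ν x) × (labels s ν x → labels (move s ι u) ν x)
  move-labels s ι t u ν x top ι≢ν = go s top em
    where
    ν≢ι : ν ≢ ι
    ν≢ι eq = ι≢ν (≡.sym eq)
    go : ∀ s → HasTop s t → (d : Dec (Returns s ι u)) →
         (labels (move′ s ι u d) ν x → labels s ν x) × (labels s ν x → labels (move′ s ι u d) ν x)
    go (push (push _ _ _) ι′ _) top (yes (≡.refl , _)) = keep ν≢ι , extend-kept ν≢ι
    go (push _ _ _)             top (no _)             = extend-kept ν≢ι , keep ν≢ι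

  State : Set (c ⊔ ℓ)
  State = Stack × Fin 3

  step : State → Step → State
  step (s , κ) (t , ι) = move s κ t , ι

  run : State → List Step → State
  run = foldl step

  -- The label 0F is never looked at, since moving from ∅ ignores it.
  start : State
  start = ∅ , 0F

  StateLabel : State → Atom → Set (c ⊔ ℓ)
  StateLabel (s , κ) = labels s κ

  infix 4 _∼ₛ_
  _∼ₛ_ : State → State → Set (c ⊔ ℓ)
  (s , κ) ∼ₛ (s′ , κ′) = s ∼ s′ × κ ≡ κ′

  run-cong : ∀ {σ σ′} xs ys → xs ≋ ys →
             σ ∼ₛ σ′ → run σ xs ∼ₛ run σ′ ys
  run-cong []             []              []               eq = eq
  run-cong {s , κ} ((t , ι) ∷ xs) ((t′ , ι) ∷ ys) ((t≈ , ≡.refl) ∷ ps) (p , ≡.refl) =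
    run-cong xs ys ps (move-cong κ t t′ p t≈ , ≡.refl)

  FitsHead : State → List Step → Set ℓ
  FitsHead (s , κ) []            = ⊤
  FitsHead (s , κ) ((t , _) ∷ _) = Fits s κ t

  stackAt : State → List Step → Triangle 𝔄 → Stack
  stackAt σ xs t = let s , κ = run σ xs in move s κ t

  valid-run : ∀ s κ xs t ι ys → Valid s → FitsHead (s , κ) (xs ++ (t , ι) ∷ ys) →
              Linked _↝_ (xs ++ (t , ι) ∷ ys) → Valid (stackAt (s , κ) xs t)
  valid-run s κ []               t ι ys v f l             = valid-move s κ t v f
  valid-run s κ ((u , ι′) ∷ [])  t ι ys v f ((_ , r) ∷ l) =
    valid-run (move s κ u) ι′ [] t ι ys (valid-move s κ u v f)
      (fits-hasTop (move s κ u) ι′ u t (hasTop-move s κ u) r) l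
  valid-run s κ ((u , ι′) ∷ xs@((w , _) ∷ _)) t ι ys v f ((_ , r) ∷ l) =
    valid-run (move s κ u) ι′ xs t ι ys (valid-move s κ u v f)
      (fits-hasTop (move s κ u) ι′ u w (hasTop-move s κ u) r) l

  fits-start : ∀ xs → FitsHead start xs
  fits-start []      = _
  fits-start (_ ∷ _) = _

  valid : ∀ xs t ι ys → Linked _↝_ (xs ++ (t , ι) ∷ ys) → Valid (stackAt start xs t)
  valid xs t ι ys = valid-run ∅ 0F xs t ι ys _ (fits-start (xs ++ (t , ι) ∷ ys))

  hasTop : ∀ σ xs t → HasTop (stackAt σ xs t) t
  hasTop σ xs t = let s , κ = run σ xs in hasTop-move s κ t

  Label : List Step → Atom → Set (c ⊔ ℓ)
  Label xs = StateLabel (run start xs)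

  label-cong : ∀ {σ σ′} → σ ∼ₛ σ′ → ∀ x → StateLabel σ x → StateLabel σ′ x
  label-cong (p , ≡.refl) x = labels-cong p

  ∼ₛ-sym : ∀ {σ σ′} → σ ∼ₛ σ′ → σ′ ∼ₛ σ
  ∼ₛ-sym (p , eq) = ∼-sym p , ≡.sym eq

  private
    _⇔_ : Set (c ⊔ ℓ) → Set (c ⊔ ℓ) → Set (c ⊔ ℓ)
    A ⇔ A′ = (A → A′) × (A′ → A)

  -- Labels belong to points, not to trails. Backtracking is handled by `move-move`, dropping by
  -- `move-labels`, and merging by the field `glued` of coherence.
  label-⟶ : ∀ {xs ys} → xs ⟶ ys → Linked _↝_ xs → Linked _↝_ ys → ∀ x → Label xs x ⇔ Label ys x
  label-⟶ (same {xs} {ys} ps) _ _ x = label-cong eq x , label-cong (∼ₛ-sym eq) x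
    where
    eq : run start xs ∼ₛ run start ys
    eq = run-cong xs ys ps (∅ , ≡.refl)
  label-⟶ (backtrack xs t ι s κ ys) _ l x
    rewrite foldl-++ step start xs ((t , ι) ∷ (s , ι) ∷ (t , κ) ∷ ys)
          | foldl-++ step start xs ((t , κ) ∷ ys) = label-cong eq x , label-cong (∼ₛ-sym eq) x
    where
    τ : Stack
    τ = stackAt start xs t
    eq : run (move (move τ ι s) ι t , κ) ys ∼ₛ run (τ , κ) ys
    eq = run-cong ys ys ≋-refl
      (move-move τ ι t s (valid xs t κ ys l) (hasTop start xs t) , ≡.refl)
  label-⟶ (drop xs t ι s ν ι≢ν) _ _ x
    rewrite foldl-++ step start xs ((t , ι) ∷ (s , ν) ∷ [])
          | foldl-++ step start xs ((t , ν) ∷ []) =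
    move-labels (stackAt start xs t) ι t s ν x (hasTop start xs t) ι≢ν
  label-⟶ (merge xs t ι κ t∈E) _ l x
    rewrite foldl-++ step start xs ((t , ι) ∷ [])
          | foldl-++ step start xs ((t , κ) ∷ []) = go t∈E
    where
    open Coherent (coherent (stackAt start xs t) t (valid xs t κ [] l) (hasTop start xs t))
    go : SuitableE 𝔄 ι κ t → labels (stackAt start xs t) ι x ⇔ labels (stackAt start xs t) κ x
    go (diagonal ≡.refl)           = (λ Lx → Lx) , (λ Lx → Lx)
    go (offDiagonal μ ι≢κ μ≢ι μ≢κ μ≤1') =
      (λ Lx → glued ι κ x Lx ικ≤1') , (λ Lx → glued κ ι x Lx (edge-identity-sym t ι κ ικ≤1'))
      where
      ικ≤1' : IsIdentity (edge t ι κ)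
      ικ≤1' = opposite-identity t ι κ μ ι≢κ μ≢ι μ≢κ μ≤1'

  PointLabel : Trail → Atom → Set (c ⊔ ℓ)
  PointLabel p = labels (stackAt start (front p) (end p)) (label p)

  label≡pointLabel : ∀ p → Label (steps p) ≡ PointLabel p
  label≡pointLabel p = ≡.cong StateLabel (foldl-++ step start (front p) ((end p , label p) ∷ []))

  pointLabel-resp : ∀ {p q} → p ≈ᵤ q → ∀ x → PointLabel p x → PointLabel q x
  pointLabel-resp ε x Lx = Lx
  pointLabel-resp {p} (_◅_ {j = r} s rs) x Lx = pointLabel-resp rs x
    (≡.subst (λ L → L x) (label≡pointLabel r)
      (across s (≡.subst (λ L → L x) (≡.sym (label≡pointLabel p)) Lx)))
    where
    across : SymClosure (_⟶_ on steps) p r → Label (steps p) x → Label (steps r) x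
    across (fwd p⟶r) = proj₁ (label-⟶ p⟶r (isLinked p) (isLinked r) x)
    across (bwd r⟶p) = proj₂ (label-⟶ r⟶p (isLinked r) (isLinked p) x)

  pointLabel-coherent : ∀ p → Coherent (λ κ → PointLabel (p ▹ κ)) (end p)
  pointLabel-coherent p = coherent (stackAt start (front p) (end p)) (end p)
    (valid (front p) (end p) (label p) [] (isLinked p)) (hasTop start (front p) (end p))

  pointLabel-single : ∀ κ → PointLabel (single t₀ ▹ κ) (edge t₀ 0F κ)
  pointLabel-single κ = go em
    where
    go : ∀ d → labels (move′ ∅ 0F t₀ d) κ (edge t₀ 0F κ)
    go (no _) = initial (B.refl {t₀}) refl

  private
    o : Atom
    o = edge t₀ 0F 0F

  -- The vertex 0 of `q` is the fixed point and inherits the identity `o` as its label; from there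
  -- the other vertices are seen along the sides of the last triangle.
  label-at-end : ∀ q → single t₀ ▹ 0F ≈ᵤ q ▹ 0F → PointLabel (q ▹ 1F) (edge (end q) 0F 1F)
  label-at-end q eq = Coherent.atIdentity (pointLabel-coherent q) 0F 1F o
    (pointLabel-resp eq o (pointLabel-single 0F)) (edge-identity t₀ 0F)

  -- If both vertices are one point, the vertex 1 carries the identity `o` besides its own label,
  -- and labels are unique.
  single-loop : single t₀ ▹ 0F ≈ᵤ single t₀ ▹ 1F → IsIdentity (edge t₀ 0F 1F)
  single-loop eq = identity-resp {o} {edge t₀ 0F 1F}
    (Coherent.unique (pointLabel-coherent (single t₀)) 1F o (edge t₀ 0F 1F)
      (pointLabel-resp eq o (pointLabel-single 0F)) (pointLabel-single 1F))
    (edge-identity t₀ 0F)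

  single-edge : ∀ q → single t₀ ▹ 0F ≈ᵤ q ▹ 0F → single t₀ ▹ 1F ≈ᵤ q ▹ 1F →
                edge (end q) 0F 1F ≈ᵃ edge t₀ 0F 1F
  single-edge q eq₀ eq₁ =
    Coherent.unique (pointLabel-coherent q) 1F (edge (end q) 0F 1F) (edge t₀ 0F 1F)
      (label-at-end q eq₀) (pointLabel-resp eq₁ (edge t₀ 0F 1F) (pointLabel-single 1F))

  -- The middle point is labelled by the side of `q`. It is also the vertex 0 of `r`, whose vertex 1
  -- has the label of the side of `t₀`; coherence on the end of `r` ties the three atoms together.
  single-composes : ∀ q r → single t₀ ▹ 0F ≈ᵤ q ▹ 0F → q ▹ 1F ≈ᵤ r ▹ 0F →
                    single t₀ ▹ 1F ≈ᵤ r ▹ 1F →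
                    Composes (edge (end q) 0F 1F) (edge (end r) 0F 1F) (edge t₀ 0F 1F)
  single-composes q r eq₀ eq₁ eq₂ =
    Coherent.composes (pointLabel-coherent r) 0F 1F (edge (end q) 0F 1F) (edge t₀ 0F 1F)
      (pointLabel-resp eq₁ (edge (end q) 0F 1F) (label-at-end q eq₀))
      (pointLabel-resp eq₂ (edge t₀ 0F 1F) (pointLabel-single 1F))

-- Deck transformations and invariant relations

module Swaps (em : ∀ {p} → ExcludedMiddle p) (𝔄 : WA c ℓ) where
  open WA 𝔄 using (sym; trans)
  open TrailEquality 𝔄
  open Trails (suitableStructure 𝔄)
  private
    module B = Setoid (Structure.B (suitableStructure 𝔄))
    module U = Setoid U
    T = Structure.T (suitableStructure 𝔄)

  -- Every rule allows an arbitrary front, which absorbs the new step; hence lengthening trails in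
  -- front respects equivalence.
  ∷-⟶ : ∀ x {xs ys} → xs ⟶ ys → (x ∷ xs) ⟶ (x ∷ ys)
  ∷-⟶ (t , ι) (same ps)                = same ((B.refl {t} , ≡.refl) ∷ ps)
  ∷-⟶ x       (backtrack xs t ι s κ ys) = backtrack (x ∷ xs) t ι s κ ys
  ∷-⟶ x       (drop xs t ι s ν ι≢ν)     = drop (x ∷ xs) t ι s ν ι≢ν
  ∷-⟶ x       (merge xs t ι κ t∈E)      = merge (x ∷ xs) t ι κ t∈E

  first′ : List Step → Triangle 𝔄 → Triangle 𝔄
  first′ []            t = t
  first′ ((f , _) ∷ _) t = f

  first : Trail → Triangle 𝔄
  first p = first′ (front p) (end p)

  StartsAt : List Step → Triangle 𝔄 → Set ℓ
  StartsAt []            u = ⊥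
  StartsAt ((t , _) ∷ _) u = t B.≈ u

  startsAt⇒ : ∀ xs {t ι u} → StartsAt (xs ∷ʳ (t , ι)) u → first′ xs t B.≈ u
  startsAt⇒ []      eq = eq
  startsAt⇒ (_ ∷ _) eq = eq

  startsAt⇐ : ∀ xs {t ι u} → first′ xs t B.≈ u → StartsAt (xs ∷ʳ (t , ι)) u
  startsAt⇐ []      eq = eq
  startsAt⇐ (_ ∷ _) eq = eq

  startsAt-⟶ : ∀ {xs ys u} → xs ⟶ ys → (StartsAt xs u → StartsAt ys u) × (StartsAt ys u → StartsAt xs u)
  startsAt-⟶ (same []) = (λ e → e) , (λ e → e)
  startsAt-⟶ {u = u} (same {(t , _) ∷ _} {(t′ , _) ∷ _} ((t≈t′ , _) ∷ _)) =
    (λ e → B.trans {t′} {t} {u} (B.sym {t} {t′} t≈t′) e) , (λ e → B.trans {t} {t′} {u} t≈t′ e)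
  startsAt-⟶ (backtrack [] t ι s κ ys)      = (λ e → e) , (λ e → e)
  startsAt-⟶ (backtrack (_ ∷ _) t ι s κ ys) = (λ e → e) , (λ e → e)
  startsAt-⟶ (drop [] t ι s ν ι≢ν)          = (λ e → e) , (λ e → e)
  startsAt-⟶ (drop (_ ∷ _) t ι s ν ι≢ν)     = (λ e → e) , (λ e → e)
  startsAt-⟶ (merge [] t ι κ t∈E)           = (λ e → e) , (λ e → e)
  startsAt-⟶ (merge (_ ∷ _) t ι κ t∈E)      = (λ e → e) , (λ e → e)

  -- Equivalent trails lie in the same tree, which makes the case distinction in `swap` well defined
  -- on points.
  first-⟶ : ∀ p q {u} → steps p ⟶ steps q →
            (first p B.≈ u → first q B.≈ u) × (first q B.≈ u → first p B.≈ u)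
  first-⟶ p q {u} r =
    (λ e → startsAt⇒ (front q) {end q} {label q} {u} (proj₁ (startsAt-⟶ {u = u} r) (startsAt⇐ (front p) {u = u} e))) ,
    (λ e → startsAt⇒ (front p) {end p} {label p} {u} (proj₂ (startsAt-⟶ {u = u} r) (startsAt⇐ (front q) {u = u} e)))

  prefix : ∀ u κ p → u B.≉ first p → T κ u (first p) → Trail
  prefix u κ (trail [] t ι l)       u≉ u~ = trail ((u , κ) ∷ []) t ι ((u≉ , u~) ∷ l)
  prefix u κ (trail (x ∷ xs) t ι l) u≉ u~ = trail ((u , κ) ∷ x ∷ xs) t ι ((u≉ , u~) ∷ l)

  steps-prefix : ∀ u κ p u≉ u~ → steps (prefix u κ p u≉ u~) ≡ (u , κ) ∷ steps p
  steps-prefix u κ (trail []       t ι l) u≉ u~ = ≡.refl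
  steps-prefix u κ (trail (x ∷ xs) t ι l) u≉ u~ = ≡.refl

  -- The deck transformation of the forest of triangles exchanging the trees rooted at s and t.
  record Adjacent : Set (c ⊔ ℓ) where
    constructor adjacent
    field
      {s t} : Triangle 𝔄
      κ     : Fin 3
      s≉t   : s B.≉ t
      s~t   : T κ s t

  module _ (a : Adjacent) where
    open Adjacent a

    private
      ≉-resp : ∀ {u v w} → u B.≉ v → w B.≈ v → u B.≉ w
      ≉-resp {u} {v} {w} u≉v w≈v u≈w = u≉v (B.trans {u} {w} {v} u≈w w≈v)

      t≉s : t B.≉ s
      t≉s t≈s = s≉t (B.sym {t} {s} t≈s)

    swap′ : ∀ p → Dec (first p B.≈ s) → Dec (first p B.≈ t) → Trail
    swap′ p (yes f≈s) _         = prefix t κ p (≉-resp {t} {s} {first p} t≉s f≈s) (trans (sym s~t) (sym (f≈s κ)))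
    swap′ p (no _)    (yes f≈t) = prefix s κ p (≉-resp {s} {t} {first p} s≉t f≈t) (trans s~t (sym (f≈t κ)))
    swap′ p (no _)    (no _)    = p

    swap : Trail → Trail
    swap p = swap′ p em em

    steps-swap-s : ∀ p → first p B.≈ s → steps (swap p) ≡ (t , κ) ∷ steps p
    steps-swap-s p f≈s = go em em
      where
      go : ∀ d d′ → steps (swap′ p d d′) ≡ (t , κ) ∷ steps p
      go (yes _)  d′ = steps-prefix t κ p _ _
      go (no f≉s) d′ = contradiction f≈s f≉s

    steps-swap-t : ∀ p → first p B.≈ t → steps (swap p) ≡ (s , κ) ∷ steps p
    steps-swap-t p f≈t = go em em
      where
      go : ∀ d d′ → steps (swap′ p d d′) ≡ (s , κ) ∷ steps p
      go (yes f≈s) d′       = contradiction (B.trans {s} {first p} {t} (B.sym {first p} {s} f≈s) f≈t) s≉t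
      go (no _)    (yes _)  = steps-prefix s κ p _ _
      go (no _)    (no f≉t) = contradiction f≈t f≉t

    steps-swap-other : ∀ p → first p B.≉ s → first p B.≉ t → steps (swap p) ≡ steps p
    steps-swap-other p f≉s f≉t = go em em
      where
      go : ∀ d d′ → steps (swap′ p d d′) ≡ steps p
      go (yes f≈s) d′        = contradiction f≈s f≉s
      go (no _)    (yes f≈t) = contradiction f≈t f≉t
      go (no _)    (no _)    = ≡.refl

    end-swap : ∀ p → end (swap p) ≡ end p
    end-swap p = go em em
      where
      end-prefix : ∀ u κ p u≉ u~ → end (prefix u κ p u≉ u~) ≡ end p
      end-prefix u κ (trail []       t ι l) u≉ u~ = ≡.refl
      end-prefix u κ (trail (x ∷ xs) t ι l) u≉ u~ = ≡.refl
      go : ∀ d d′ → end (swap′ p d d′) ≡ end p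
      go (yes _) _       = end-prefix t κ p _ _
      go (no _)  (yes _) = end-prefix s κ p _ _
      go (no _)  (no _)  = ≡.refl

    swap-▹ : ∀ p ι → swap (p ▹ ι) ≈ᵤ swap p ▹ ι
    swap-▹ p ι = ≡⇒≈ (go em em)
      where
      steps-prefix-▹ : ∀ u κ p u≉ u~ → steps (prefix u κ p u≉ u~ ▹ ι) ≡ (u , κ) ∷ steps (p ▹ ι)
      steps-prefix-▹ u κ (trail []       t ι l) u≉ u~ = ≡.refl
      steps-prefix-▹ u κ (trail (x ∷ xs) t ι l) u≉ u~ = ≡.refl
      go : ∀ d d′ → steps (swap′ (p ▹ ι) d d′) ≡ steps (swap′ p d d′ ▹ ι)
      go (yes _) _       = ≡.trans (steps-prefix t κ (p ▹ ι) _ _) (≡.sym (steps-prefix-▹ t κ p _ _))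
      go (no _)  (yes _) = ≡.trans (steps-prefix s κ (p ▹ ι) _ _) (≡.sym (steps-prefix-▹ s κ p _ _))
      go (no _)  (no _)  = ≡.refl

    swap-⟶ : ∀ p q → steps p ⟶ steps q → steps (swap p) ⟶ steps (swap q)
    swap-⟶ p q r = go em em
      where
      go : Dec (first p B.≈ s) → Dec (first p B.≈ t) → steps (swap p) ⟶ steps (swap q)
      go (yes f≈s) _ = ≡.subst₂ _⟶_
        (≡.sym (steps-swap-s p f≈s)) (≡.sym (steps-swap-s q (proj₁ (first-⟶ p q {s} r) f≈s)))
        (∷-⟶ (t , κ) r)
      go (no _) (yes f≈t) = ≡.subst₂ _⟶_
        (≡.sym (steps-swap-t p f≈t)) (≡.sym (steps-swap-t q (proj₁ (first-⟶ p q {t} r) f≈t)))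
        (∷-⟶ (s , κ) r)
      go (no f≉s) (no f≉t) = ≡.subst₂ _⟶_
        (≡.sym (steps-swap-other p f≉s f≉t))
        (≡.sym (steps-swap-other q (λ e → f≉s (proj₂ (first-⟶ p q {s} r) e))
                                   (λ e → f≉t (proj₂ (first-⟶ p q {t} r) e))))
        r

    swap-cong : ∀ {p q} → p ≈ᵤ q → swap p ≈ᵤ swap q
    swap-cong = EqC.gmap swap (λ {p} {q} → swap-⟶ p q)

    first-swap-s : ∀ p → first p B.≈ s → first (swap p) B.≈ t
    first-swap-s p f≈s = startsAt⇒ (front (swap p)) {end (swap p)} {label (swap p)} {t}
      (≡.subst (λ xs → StartsAt xs t) (≡.sym (steps-swap-s p f≈s)) (B.refl {t}))

    first-swap-t : ∀ p → first p B.≈ t → first (swap p) B.≈ s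
    first-swap-t p f≈t = startsAt⇒ (front (swap p)) {end (swap p)} {label (swap p)} {s}
      (≡.subst (λ xs → StartsAt xs s) (≡.sym (steps-swap-t p f≈t)) (B.refl {s}))

  -- The backtracking rule needs literally the same triangle on both sides of the excursion, while
  -- `first p` merely equals `u` in the setoid. The trail `detour` substitutes it for `u`
  -- beforehand.
  backtrack-first : ∀ κ u v p q → u B.≉ v → T κ u v → first p B.≈ u →
                    steps q ≡ (u , κ) ∷ (v , κ) ∷ steps p → q ≈ᵤ p
  backtrack-first κ u v p@(trail xs t ι l) q u≉v u~v f≈u eq = U.trans {q} {detour xs l f≈u} {p}
    
    (⟶⇒≈ (≡.subst (_⟶ steps (detour xs l f≈u)) (≡.sym eq) (replaced xs l f≈u)))
    (⟶⇒≈ (undone xs l f≈u))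
    where
    v≉f : ∀ {f} → f B.≈ u → v B.≉ f
    v≉f {f} f≈u v≈f = u≉v (B.sym {v} {u} (B.trans {v} {f} {u} v≈f f≈u))
    f≉v : ∀ {f} → f B.≈ u → f B.≉ v
    f≉v {f} f≈u f≈v = v≉f {f} f≈u (B.sym {f} {v} f≈v)
    f~v : ∀ {f} → f B.≈ u → T κ f v
    f~v f≈u = trans (f≈u κ) u~v
    detour : ∀ xs → Linked _↝_ (xs ∷ʳ (t , ι)) → first′ xs t B.≈ u → Trail
    detour [] l t≈u = trail ((t , κ) ∷ (v , κ) ∷ []) t ι
      ((f≉v {t} t≈u , f~v {t} t≈u) ∷ (v≉f {t} t≈u , sym (f~v {t} t≈u)) ∷ l)
    detour ((f , ν) ∷ xs) l f≈u = trail ((f , κ) ∷ (v , κ) ∷ (f , ν) ∷ xs) t ι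
      ((f≉v {f} f≈u , f~v {f} f≈u) ∷ (v≉f {f} f≈u , sym (f~v {f} f≈u)) ∷ l)
    replaced : ∀ xs l f≈u → ((u , κ) ∷ (v , κ) ∷ (xs ∷ʳ (t , ι))) ⟶ steps (detour xs l f≈u)
    replaced []             l t≈u = same ((B.sym {t} {u} t≈u , ≡.refl) ∷ ≋-refl)
    replaced ((f , ν) ∷ xs) l f≈u = same ((B.sym {f} {u} f≈u , ≡.refl) ∷ ≋-refl)
    undone : ∀ xs l f≈u → steps (detour xs l f≈u) ⟶ (xs ∷ʳ (t , ι))
    undone []             l t≈u = backtrack [] t κ v ι []
    undone ((f , ν) ∷ xs) l f≈u = backtrack [] f κ v ν (xs ∷ʳ (t , ι))

  module _ (a : Adjacent) where
    open Adjacent a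

    swap-involutive : ∀ p → swap a (swap a p) ≈ᵤ p
    swap-involutive p = go em em
      where
      go : Dec (first p B.≈ s) → Dec (first p B.≈ t) → swap a (swap a p) ≈ᵤ p
      go (yes f≈s) _ = backtrack-first κ s t p (swap a (swap a p)) s≉t s~t f≈s
        (≡.trans (steps-swap-t a (swap a p) (first-swap-s a p f≈s))
          (≡.cong ((s , κ) ∷_) (steps-swap-s a p f≈s)))
      go (no _) (yes f≈t) = backtrack-first κ t s p (swap a (swap a p)) t≉s (sym s~t) f≈t
        (≡.trans (steps-swap-s a (swap a p) (first-swap-t a p f≈t))
          (≡.cong ((t , κ) ∷_) (steps-swap-t a p f≈t)))
        where
        t≉s : t B.≉ s
        t≉s t≈s = s≉t (B.sym {t} {s} t≈s)
      go (no f≉s) (no f≉t) = ≡⇒≈ (≡.trans (steps-swap-other a (swap a p) f′≉s f′≉t) steps≡)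
        where
        steps≡ : steps (swap a p) ≡ steps p
        steps≡ = steps-swap-other a p f≉s f≉t
        f′≉s : first (swap a p) B.≉ s
        f′≉s e = f≉s (proj₁ (first-⟶ (swap a p) p {s} (≡⇒⟶ steps≡)) e)
        f′≉t : first (swap a p) B.≉ t
        f′≉t e = f≉t (proj₁ (first-⟶ (swap a p) p {t} (≡⇒⟶ steps≡)) e)

  Invariant : BinRel U → Set (c ⊔ ℓ)
  Invariant R = ∀ a u v → BinRel.rel R u v → BinRel.rel R (swap a u) (swap a v)

  invariant-swap⁻ : ∀ {R} → Invariant R → ∀ a u v → BinRel.rel R (swap a u) (swap a v) → BinRel.rel R u v
  invariant-swap⁻ {R} inv a u v r =
    BinRel.resp R {swap a (swap a u)} {u} {swap a (swap a v)} {v}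
      (swap-involutive a u) (swap-involutive a v) (inv a (swap a u) (swap a v) r)

  At01 : BinRel U → Trail → Set (c ⊔ ℓ)
  At01 R p = BinRel.rel R (p ▹ 0F) (p ▹ 1F)

  At01-resp : ∀ R {p q} → p ▹ 0F ≈ᵤ q ▹ 0F → p ▹ 1F ≈ᵤ q ▹ 1F → At01 R p → At01 R q
  At01-resp R {p} {q} = BinRel.resp R {p ▹ 0F} {q ▹ 0F} {p ▹ 1F} {q ▹ 1F}

  -- The swap of s and t takes p to the trail p extended in front by s.
  unroll : ∀ {R} → Invariant R → ∀ a p q → first p B.≈ Adjacent.t a →
           (∀ ι → steps (q ▹ ι) ≡ (Adjacent.s a , Adjacent.κ a) ∷ steps (p ▹ ι)) →
           (At01 R p → At01 R q) × (At01 R q → At01 R p)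
  unroll {R} inv a p q f≈t eq =
    (λ r → BinRel.resp R {swap a (p ▹ 0F)} {q ▹ 0F} {swap a (p ▹ 1F)} {q ▹ 1F} (swapped 0F) (swapped 1F)
             (inv a (p ▹ 0F) (p ▹ 1F) r)) ,
    (λ r → invariant-swap⁻ {R} inv a (p ▹ 0F) (p ▹ 1F)
             (BinRel.resp R {q ▹ 0F} {swap a (p ▹ 0F)} {q ▹ 1F} {swap a (p ▹ 1F)}
               (U.sym {swap a (p ▹ 0F)} {q ▹ 0F} (swapped 0F))
               (U.sym {swap a (p ▹ 1F)} {q ▹ 1F} (swapped 1F)) r))
    where
    swapped : ∀ ι → swap a (p ▹ ι) ≈ᵤ q ▹ ι
    swapped ι = ≡⇒≈ (≡.trans (steps-swap-t a (p ▹ ι) f≈t) (≡.sym (eq ι)))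

  -- Removing the leading triangle is the effect of swapping it with its successor; by induction
  -- only the last triangle remains.
  reroot : ∀ {R} → Invariant R → ∀ p → (At01 R p → At01 R (single (end p))) ×
                                       (At01 R (single (end p)) → At01 R p)
  reroot {R} inv (trail xs t ι l) = go xs l
    where
    go : ∀ xs (l : Linked _↝_ (xs ∷ʳ (t , ι))) →
         (At01 R (trail xs t ι l) → At01 R (single t)) × (At01 R (single t) → At01 R (trail xs t ι l))
    go [] l = At01-resp R {trail [] t ι l} {single t} (≡⇒≈ ≡.refl) (≡⇒≈ ≡.refl)
            , At01-resp R {single t} {trail [] t ι l} (≡⇒≈ ≡.refl) (≡⇒≈ ≡.refl)
    go ((s , κ) ∷ []) ((s≉t , s~t) ∷ l) =
      let to , from = go [] l
          up , down = unroll {R} inv (adjacent {s} {t} κ s≉t s~t)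
            (trail [] t ι l) (trail ((s , κ) ∷ []) t ι ((s≉t , s~t) ∷ l)) (B.refl {t}) (λ _ → ≡.refl)
      in (λ r → to (down r)) , (λ r → up (from r))
    go ((s , κ) ∷ (u , ν) ∷ xs) ((s≉u , s~u) ∷ l) =
      let to , from = go ((u , ν) ∷ xs) l
          up , down = unroll {R} inv (adjacent {s} {u} κ s≉u s~u)
            (trail ((u , ν) ∷ xs) t ι l) (trail ((s , κ) ∷ (u , ν) ∷ xs) t ι ((s≉u , s~u) ∷ l))
            (B.refl {u}) (λ _ → ≡.refl)
      in (λ r → to (down r)) , (λ r → up (from r))

  -- The step from `s` to `t` moves the vertex 2 only, so the trail through both has the vertices 0
  -- and 1 of `single s`, while re-rooting turns it into `single t`. An invariant relation thus sees
  -- nothing but the entry 2 of a triangle.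
  invariant-single : ∀ {R} → Invariant R → ∀ s t → T 2F s t → At01 R (single t) → At01 R (single s)
  invariant-single {R} inv s t s~t r = go em
    where
    go : Dec (s B.≈ t) → At01 R (single s)
    go (yes s≈t) = At01-resp R {single t} {single s} (move 0F) (move 1F) r
      where
      move : ∀ κ → single t ▹ κ ≈ᵤ single s ▹ κ
      move κ = ⟶⇒≈ (same ((B.sym {s} {t} s≈t , ≡.refl) ∷ []))
    go (no s≉t) = At01-resp R {q} {single s} (dropped 0F λ ()) (dropped 1F λ ()) (proj₂ (reroot {R} inv q) r)
      where
      q : Trail
      q = trail ((s , 2F) ∷ []) t 0F ((s≉t , s~t) ∷ [-])
      dropped : ∀ κ → 2F ≢ κ → q ▹ κ ≈ᵤ single s ▹ κ
      dropped κ 2≢κ = ⟶⇒≈ (drop [] s 2F t κ 2≢κ)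

-- Every side of a triangle as a side from 0 to 1

module Edges (em : ∀ {p} → ExcludedMiddle p) (𝔄 : WA c ℓ) (atomic : Atomic 𝔄) where
  open WA 𝔄
  open BooleanLaws 𝔄
  open AtomLaws 𝔄
  open Networks em 𝔄 atomic
  open TrailEquality 𝔄
  open Trails (suitableStructure 𝔄)
  private
    module B = Setoid (Structure.B (suitableStructure 𝔄))
    module U = Setoid U
    T = Structure.T (suitableStructure 𝔄)

  linked-∷ʳ : ∀ xs {t κ s ν} → Linked _↝_ (xs ∷ʳ (t , κ)) → t B.≉ s → T κ t s →
              Linked _↝_ ((xs ∷ʳ (t , κ)) ∷ʳ (s , ν))
  linked-∷ʳ []           [-]      t≉s t~s = (t≉s , t~s) ∷ [-]
  linked-∷ʳ (_ ∷ [])     (r ∷ l)  t≉s t~s = r ∷ linked-∷ʳ [] l t≉s t~s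
  linked-∷ʳ (_ ∷ y ∷ xs) (r ∷ l)  t≉s t~s = r ∷ linked-∷ʳ (y ∷ xs) l t≉s t~s

  record Change (p : Trail) (κ : Fin 3) (s : Triangle 𝔄) : Set (c ⊔ ℓ) where
    field
      changed : Trail
      endsAt  : changed EndsAt s
      fixes   : ∀ ν → κ ≢ ν → p ▹ ν ≈ᵤ changed ▹ ν

  change : ∀ p κ s → T κ (end p) s → Change p κ s
  change p κ s t~s = go em
    where
    go : Dec (end p B.≈ s) → Change p κ s
    -- Consecutive triangles of a trail must differ, so no step is made here.
    go (yes t≈s) = record { changed = p ; endsAt = t≈s ; fixes = λ ν _ → U.refl {p ▹ ν} }
    go (no t≉s)  = record { changed = q ; endsAt = B.refl {s} ; fixes = fixes }
      where
      q : Trail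
      q = trail (front p ∷ʳ (end p , κ)) s 0F (linked-∷ʳ (front p) (isLinked (p ▹ κ)) t≉s t~s)
      fixes : ∀ ν → κ ≢ ν → p ▹ ν ≈ᵤ q ▹ ν
      fixes ν κ≢ν = U.sym {q ▹ ν} {p ▹ ν} (⟶⇒≈ {q ▹ ν} {p ▹ ν} (≡.subst (_⟶ steps (p ▹ ν))
        (≡.sym (++-assoc (front p) ((end p , κ) ∷ []) ((s , ν) ∷ [])))
        (drop (front p) (end p) κ s ν κ≢ν)))

  merged : ∀ p s κ ν μ → p EndsAt s → κ ≢ ν → μ ≢ κ → μ ≢ ν → _⟨_⟩ 𝔄 s μ ≤ 1' → p ▹ κ ≈ᵤ p ▹ ν
  merged p s κ ν μ t≈s κ≢ν μ≢κ μ≢ν s≤1' = ⟶⇒≈ {p ▹ κ} {p ▹ ν} (merge (front p) (end p) κ ν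
    (offDiagonal μ κ≢ν μ≢κ μ≢ν (≤-trans (≤-reflexive (t≈s μ)) s≤1')))

  Edge : Trail → Trail → Atom → Set (c ⊔ ℓ)
  Edge u v a = ∃[ p ] edge (end p) 0F 1F ≈ᵃ a × u ≈ᵤ p ▹ 0F × v ≈ᵤ p ▹ 1F

  edge-resp : ∀ {u u′ v v′ a a′} → u′ ≈ᵤ u → v′ ≈ᵤ v → a ≈ᵃ a′ → Edge u v a → Edge u′ v′ a′
  edge-resp {u} {u′} {v} {v′} u′≈u v′≈v a≈a′ (p , eq , u≈ , v≈) =
    p , trans eq a≈a′ , U.trans {u′} {u} {p ▹ 0F} u′≈u u≈ , U.trans {v′} {v} {p ▹ 1F} v′≈v v≈

  triple : (a b d : Atom) → Composes d a b → Triangle 𝔄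
  triple a b d b≤ = (λ { 0F → a ; 1F → b ; 2F → d }) , b≤

  -- The vertex 1 is moved onto the vertex 2: in the new triangle the side between them is a loop,
  -- which merges the two points.
  edge-02 : ∀ p → Edge (p ▹ 0F) (p ▹ 2F) (edge (end p) 0F 2F)
  edge-02 p = changed , endsAt 2F , fixes 0F (λ ()) ,
    U.trans {p ▹ 2F} {changed ▹ 2F} {changed ▹ 1F} (fixes 2F (λ ()))
      (merged changed s 2F 1F 0F endsAt (λ ()) (λ ()) (λ ()) (edge-identity t 2F))
    where
    t s : Triangle 𝔄
    t = end p
    s = triple (edge t 2F 2F) (edge t 0F 2F) (edge t 0F 2F) (edge-idʳ t 0F 2F)
    open Change (change p 1F s refl)

  edge-12 : ∀ p → Edge (p ▹ 1F) (p ▹ 2F) (edge (end p) 1F 2F)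
  edge-12 p = edge-resp {changed ▹ 0F} {p ▹ 1F} {changed ▹ 2F} {p ▹ 2F}
    {edge (end changed) 0F 2F} {edge t 1F 2F}
    (U.trans {p ▹ 1F} {changed ▹ 1F} {changed ▹ 0F} (fixes 1F (λ ()))
      (merged changed s 1F 0F 2F endsAt (λ ()) (λ ()) (λ ()) (edge-identity t 1F)))
    (fixes 2F (λ ())) (endsAt 1F) (edge-02 changed)
    where
    t s : Triangle 𝔄
    t = end p
    -- The side from 0 to 1 is a loop, so the vertex 0 moves onto the vertex 1.
    s = triple (edge t 1F 2F) (edge t 1F 2F) (edge t 1F 1F) (edge-idˡ t 1F 2F)
    open Change (change p 0F s refl)

  edge-10 : ∀ p → Edge (p ▹ 1F) (p ▹ 0F) (edge (end p) 1F 0F)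
  edge-10 p = edge-resp {changed ▹ 1F} {p ▹ 1F} {changed ▹ 2F} {p ▹ 0F}
    {edge (end changed) 1F 2F} {edge t 1F 0F}
    (fixes 1F (λ ()))
    (U.trans {p ▹ 0F} {changed ▹ 0F} {changed ▹ 2F} (fixes 0F (λ ()))
      (merged changed s 0F 2F 1F endsAt (λ ()) (λ ()) (λ ()) (edge-identity t 0F)))
    (endsAt 0F) (edge-12 changed)
    where
    t s : Triangle 𝔄
    t = end p
    -- The side from 0 to 2 is a loop, so the vertex 2 moves onto the vertex 0.
    s = triple (edge t 1F 0F) (edge t 0F 0F) (edge t 0F 1F) (edge-loop t 0F 1F)
    open Change (change p 2F s refl)

  edge-flip : ∀ {u v a} → Edge u v a → Edge v u (a ˘ᵃ)
  edge-flip {u} {v} {a} (p , eq , u≈ , v≈) =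
    edge-resp {p ▹ 1F} {v} {p ▹ 0F} {u} {edge (end p) 1F 0F} {a ˘ᵃ} v≈ u≈ (˘-cong eq) (edge-10 p)

  -- Every consistent triple of atoms is a triangle, so the vertex 2 can be moved to an apex with
  -- sides `a` and `b`; it is the required middle point.
  edge-split : ∀ p a b → Composes a b (edge (end p) 0F 1F) →
               ∃[ w ] Edge (p ▹ 0F) w a × Edge w (p ▹ 1F) b
  edge-split p a b abt = changed ▹ 2F ,
    edge-resp {changed ▹ 0F} {p ▹ 0F} {changed ▹ 2F} {changed ▹ 2F} {edge (end changed) 0F 2F} {a}
      (fixes 0F (λ ())) (U.refl {changed ▹ 2F}) (endsAt 1F) (edge-02 changed) ,
    edge-resp {changed ▹ 2F} {changed ▹ 2F} {changed ▹ 1F} {p ▹ 1F} {edge (end changed) 1F 2F ˘ᵃ} {b}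
      (U.refl {changed ▹ 2F}) (fixes 1F (λ ()))
      (trans (˘-cong (endsAt 0F)) (˘ᵃ-involutive b))
      (edge-flip {a = edge (end changed) 1F 2F} (edge-12 changed))
    where
    t s : Triangle 𝔄
    t = end p
    s = triple (b ˘ᵃ) a (edge t 0F 1F) (cycleʳ a b (edge t 0F 1F) abt)
    open Change (change p 2F s refl)

-- The representation and its image

module Representation (em : ∀ {p} → ExcludedMiddle p) (𝔄 : WA c ℓ)
                      (complete : Complete 𝔄) (atomic : Atomic 𝔄) where
  open WA 𝔄
  open BooleanLaws 𝔄
  open RelationLaws 𝔄
  open AtomLaws 𝔄
  open AtomicLaws em 𝔄 atomic
  open Networks em 𝔄 atomic
  open TrailEquality 𝔄
  open Swaps em 𝔄
  open Edges em 𝔄 atomic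
  open Trails (suitableStructure 𝔄)
  open BinRel
  private
    module B = Setoid (Structure.B (suitableStructure 𝔄))
    module U = Setoid U
    module Re = Algebra (Re U)
    module Rl = Algebra (RlOperations S)

  ends : Trail → Atom
  ends p = edge (end p) 0F 1F

  h : Carrier → BinRel U
  h x = binRel (λ u v → ∃[ p ] ∣ ends p ∣ ≤ x × u ≈ᵤ p ▹ 0F × v ≈ᵤ p ▹ 1F)
    λ {u} {u′} {v} {v′} u≈u′ v≈v′ (p , le , u≈ , v≈) → p , le
      , U.trans {u′} {u} {p ▹ 0F} (U.sym {u} {u′} u≈u′) u≈
      , U.trans {v′} {v} {p ▹ 1F} (U.sym {v} {v′} v≈v′) v≈

  h-mono : ∀ {x y} → x ≤ y → ∀ {u v} → rel (h x) u v → rel (h y) u v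
  h-mono x≤y (p , le , u≈ , v≈) = p , ≤-trans le x≤y , u≈ , v≈

  h-cong : ∀ {x y} → x ≈ y → h x Re.≈ h y
  h-cong {x} {y} x≈y = ext ( (λ {u} {v} → h-mono (≤-reflexive x≈y) {u} {v})
                           , (λ {u} {v} → h-mono (≤-reflexive (sym x≈y)) {u} {v}))

  h-trail : ∀ {x} p → ∣ ends p ∣ ≤ x → At01 (h x) p
  h-trail p le = p , le , U.refl {p ▹ 0F} , U.refl {p ▹ 1F}

  edge⇒h : ∀ {u v a x} → ∣ a ∣ ≤ x → Edge u v a → rel (h x) u v
  edge⇒h a≤x (p , eq , u≈ , v≈) = p , ≤-trans (≤-reflexive eq) a≤x , u≈ , v≈

  h⊆S : ∀ {x u v} → rel (h x) u v → rel S u v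
  h⊆S (p , _ , u≈ , v≈) = p ▹ 2F , end p , p , B.refl {end p} , u≈ , v≈ , U.refl {p ▹ 2F}

  S-trail : ∀ {u v} → rel S u v → ∃[ p ] u ≈ᵤ p ▹ 0F × v ≈ᵤ p ▹ 1F
  S-trail (_ , _ , p , _ , u≈ , v≈ , _) = p , u≈ , v≈

  at-trail : ∀ R {u v p} → u ≈ᵤ p ▹ 0F → v ≈ᵤ p ▹ 1F → rel R u v → At01 R p
  at-trail R {u} {v} {p} = resp R {u} {p ▹ 0F} {v} {p ▹ 1F}

  from-trail : ∀ R {u v p} → u ≈ᵤ p ▹ 0F → v ≈ᵤ p ▹ 1F → At01 R p → rel R u v
  from-trail R {u} {v} {p} u≈ v≈ =
    resp R {p ▹ 0F} {u} {p ▹ 1F} {v} (U.sym {u} {p ▹ 0F} u≈) (U.sym {v} {p ▹ 1F} v≈)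

  -- Swaps act on points as involutions, which gives closure under complement; in a composition the
  -- middle point is swapped along. The lift only adjusts the level.
  invariant : Subalgebra (Re U) (suc (c ⊔ ℓ))
  invariant = record
    { universe      = λ R → Level.Lift (suc (c ⊔ ℓ)) (Invariant R)
    ; isSubuniverse = record
      { respects  = λ { (ext (f , g)) (Level.lift inv) →
          Level.lift λ a u v r → f (inv a u v (g r)) }
      ; +-closed  = λ { (Level.lift inv) (Level.lift inv′) →
          Level.lift λ a u v → Sum.map (inv a u v) (inv′ a u v) }
      ; -‿closed  = λ { {R} (Level.lift inv) →
          Level.lift λ a u v ¬r r → ¬r (invariant-swap⁻ {R} inv a u v r) }
      ; ⨾-closed  = λ { (Level.lift inv) (Level.lift inv′) →
          Level.lift λ a u v (w , r , r′) → swap a w , inv a u w r , inv′ a w v r′ }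
      ; ˘-closed  = λ { (Level.lift inv) → Level.lift λ a u v → inv a v u }
      ; 1'-closed = Level.lift λ { a u v (Level.lift u≈v) → Level.lift (swap-cong a {u} {v} u≈v) }
      }
    }

  open Subalgebra invariant using (⨾-closed; 1'-closed)

  h-invariant : ∀ x → Invariant (h x)
  h-invariant x a u v (p , le , u≈ , v≈) = swap a p
    , ≤-trans (≤-reflexive (reflexive (≡.cong (λ t → ∣ edge t 0F 1F ∣) (end-swap a p)))) le
    , U.trans {swap a u} {swap a (p ▹ 0F)} {swap a p ▹ 0F} (swap-cong a {u} {p ▹ 0F} u≈) (swap-▹ a p 0F)
    , U.trans {swap a v} {swap a (p ▹ 1F)} {swap a p ▹ 1F} (swap-cong a {v} {p ▹ 1F} v≈) (swap-▹ a p 1F)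

  to-single : ∀ {R} → Level.Lift (suc (c ⊔ ℓ)) (Invariant R) → ∀ p → At01 R p → At01 R (single (end p))
  to-single {R} (Level.lift inv) p = proj₁ (reroot {R} inv p)

  -- Many trails represent the same pair. Re-rooting at the end of `p` lets `single-edge` show that
  -- they all carry one label, so that `h x` and `h (- x)` are disjoint.
  h-label : ∀ {x} p → At01 (h x) p → ∣ ends p ∣ ≤ x
  h-label {x} p r = at-root (to-single {h x} (Level.lift (h-invariant x)) p r)
    where
    open Stacks em 𝔄 atomic (end p)
    at-root : At01 (h x) (single (end p)) → ∣ ends p ∣ ≤ x
    at-root (q , le , u≈ , v≈) =
      ≤-trans (≤-reflexive (sym (single-edge q u≈ v≈))) le

  -- The composite is invariant, so the pair may be moved to the root, where `single-composes`
  -- relates its label to those of the factors for any middle point.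
  h-⨾⊆ : ∀ {x y} p → At01 (h x Re.⨾ h y) p → ∣ ends p ∣ ≤ x ⨾ y
  h-⨾⊆ {x} {y} p r =
    at-root (to-single {h x Re.⨾ h y}
      (⨾-closed {h x} {h y} (Level.lift (h-invariant x)) (Level.lift (h-invariant y))) p r)
    where
    open Stacks em 𝔄 atomic (end p)
    at-root : At01 (h x Re.⨾ h y) (single (end p)) → ∣ ends p ∣ ≤ x ⨾ y
    at-root (w , (q , q≤x , u≈ , w≈) , (r , r≤y , w≈′ , v≈)) = ≤-trans
      (single-composes q r u≈
        (U.trans {q ▹ 1F} {w} {r ▹ 0F} (U.sym {w} {q ▹ 1F} w≈) w≈′) v≈)
      (⨾-mono q≤x r≤y)

  1'⇒identity : ∀ p → At01 Re.1' p → ∣ ends p ∣ ≤ 1'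
  1'⇒identity p r = at-root (to-single {Re.1'} 1'-closed p r)
    where
    open Stacks em 𝔄 atomic (end p)
    at-root : At01 Re.1' (single (end p)) → ∣ ends p ∣ ≤ 1'
    at-root (Level.lift eq) = single-loop eq

  h-+ : ∀ x y → h (x + y) Re.≈ (h x Rl.+ h y)
  h-+ x y = ext (to , from)
    where
    to : ∀ {u v} → rel (h (x + y)) u v → rel (h x Rl.+ h y) u v
    to {u} {v} r@(p , le , u≈ , v≈) =
      Sum.map (λ p≤x → p , p≤x , u≈ , v≈) (λ p≤y → p , p≤y , u≈ , v≈) (atom-≤-+ (ends p) le)
      , h⊆S {x + y} {u} {v} r
    from : ∀ {u v} → rel (h x Rl.+ h y) u v → rel (h (x + y)) u v
    from {u} {v} (inj₁ r , _) = h-mono (x≤x+y x y) {u} {v} r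
    from {u} {v} (inj₂ r , _) = h-mono (y≤x+y x y) {u} {v} r

  h-‿ : ∀ x → h (- x) Re.≈ (Rl.- h x)
  h-‿ x = ext (to , from)
    where
    to : ∀ {u v} → rel (h (- x)) u v → rel (Rl.- h x) u v
    to {u} {v} r@(p , le , u≈ , v≈) =
      (λ r′ → atom-≰- (ends p) (h-label p (at-trail (h x) {u} {v} {p} u≈ v≈ r′)) le) , h⊆S { - x} {u} {v} r
    from : ∀ {u v} → rel (Rl.- h x) u v → rel (h (- x)) u v
    from {u} {v} (¬r , s) =
      let p , u≈ , v≈ = S-trail {u} {v} s in
      p
      , [ (λ p≤x → contradiction (p , p≤x , u≈ , v≈) ¬r) , (λ le → le) ]′ (atom-≤⊎≤- (ends p) x)
      , u≈ , v≈

  h-⨾ : ∀ x y → h (x ⨾ y) Re.≈ (h x Rl.⨾ h y)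
  h-⨾ x y = ext (to , from)
    where
    to : ∀ {u v} → rel (h (x ⨾ y)) u v → rel (h x Rl.⨾ h y) u v
    to {u} {v} r@(p , le , u≈ , v≈) =
      let a , b , a≤x , b≤y , abp = split (ends p) le
          w , uw , wv = edge-split p a b abp
      in from-trail (h x Re.⨾ h y) {u} {v} {p} u≈ v≈
           (w , edge⇒h {p ▹ 0F} {w} {a} a≤x uw , edge⇒h {w} {p ▹ 1F} {b} b≤y wv)
         , h⊆S {x ⨾ y} {u} {v} r
    from : ∀ {u v} → rel (h x Rl.⨾ h y) u v → rel (h (x ⨾ y)) u v
    from {u} {v} (r , s) =
      let p , u≈ , v≈ = S-trail {u} {v} s in
      p , h-⨾⊆ p (at-trail (h x Re.⨾ h y) {u} {v} {p} u≈ v≈ r) , u≈ , v≈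

  h-flip : ∀ x {u v} → rel (h x) u v → rel (h (x ˘)) v u
  h-flip x {u} {v} (p , le , u≈ , v≈) =
    edge⇒h {v} {u} {ends p ˘ᵃ} (˘-mono le) (edge-flip {u} {v} {ends p} (p , refl , u≈ , v≈))

  h-˘ : ∀ x → h (x ˘) Re.≈ (h x Rl.˘)
  h-˘ x = ext (to , from)
    where
    to : ∀ {u v} → rel (h (x ˘)) u v → rel (h x Rl.˘) u v
    to {u} {v} r =
      h-mono (≤-reflexive (˘-involutive x)) {v} {u} (h-flip (x ˘) {u} {v} r) , h⊆S {x ˘} {u} {v} r
    from : ∀ {u v} → rel (h x Rl.˘) u v → rel (h (x ˘)) u v
    from {u} {v} (r , _) = h-flip x {v} {u} r

  h-1' : h 1' Re.≈ Rl.1'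
  h-1' = ext (to , from)
    where
    to : ∀ {u v} → rel (h 1') u v → rel Rl.1' u v
    to {u} {v} r@(p , le , u≈ , v≈) =
      from-trail Re.1' {u} {v} {p} u≈ v≈
        (Level.lift (merged p (end p) 0F 1F 2F (B.refl {end p}) (λ ()) (λ ()) (λ ()) le))
      , h⊆S {1'} {u} {v} r
    from : ∀ {u v} → rel Rl.1' u v → rel (h 1') u v
    from {u} {v} (r , s) =
      let p , u≈ , v≈ = S-trail {u} {v} s in
      p , 1'⇒identity p (at-trail Re.1' {u} {v} {p} u≈ v≈ r) , u≈ , v≈

  -- The range identity of `a` completes it to a degenerate triangle. As every atom thus occurs as a
  -- side, `h` is injective.
  atom-triangle : ∀ (a : Atom) → ∃[ t ] edge t 0F 1F ≈ᵃ a
  atom-triangle a =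
    let e , _ , aea = splitʳ a (≤-reflexive (sym (⨾-identityʳ ∣ a ∣)))
    in triple e a a aea , refl

  h-reflects-≤ : ∀ {x y} → (∀ {u v} → rel (h x) u v → rel (h y) u v) → x ≤ y
  h-reflects-≤ {x} {y} hx⊆hy = ≤-from-atoms λ a a≤x →
    let t , t≈a = atom-triangle a
        p = single t
    in ≤-trans (≤-reflexive (sym t≈a))
         (h-label p (hx⊆hy {p ▹ 0F} {p ▹ 1F} (h-trail p (≤-trans (≤-reflexive t≈a) a≤x))))

  module _ (R : BinRel U) (inv : Invariant R) where

    Occurs : Carrier → Set (c ⊔ ℓ)
    Occurs x = ∃[ t ] x ≈ ∣ edge t 0F 1F ∣ × At01 R (single t)

    -- The only use of completeness: this sum of labels is the element that `h` sends to `R ⊓ S`.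
    supremum : ∃ (IsSupremum 𝔄 Occurs)
    supremum = complete Occurs λ { x≈y (t , x≈ , r) → t , trans (sym x≈y) x≈ , r }

    occurs⇒ : ∀ p → Occurs ∣ ends p ∣ → At01 R p
    occurs⇒ p (t , eq , r) = proj₂ (reroot {R} inv p) (invariant-single {R} inv (end p) t eq r)

    -- An atom that does not occur is disjoint from all that do, so its complement bounds them and
    -- the atom cannot lie below their supremum.
    below⇒occurs : ∀ (a : Atom) → ∣ a ∣ ≤ proj₁ supremum → Occurs ∣ a ∣
    below⇒occurs a a≤sup = go em
      where
      go : Dec (Occurs ∣ a ∣) → Occurs ∣ a ∣
      go (yes occurs) = occurs
      go (no ¬occurs) = contradiction
        (≤-trans a≤sup (proj₂ (proj₂ supremum) (- ∣ a ∣) below)) (atom-≰- a ≤-refl)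
        where
        below : ∀ x → Occurs x → x ≤ - ∣ a ∣
        below x (t , x≈ , r) = ≤-‿swap
          ([ (λ a≤x → contradiction
                (t , atom-≤⇒≈ a (edge t 0F 1F) (≤-trans a≤x (≤-reflexive x≈)) , r) ¬occurs)
           , (λ a≤-x → a≤-x) ]′ (atom-≤⊎≤- a x))

    h-supremum : (R ⊓ S) Re.≈ h (proj₁ supremum)
    h-supremum = ext (to , from)
      where
      to : ∀ {u v} → rel (R ⊓ S) u v → rel (h (proj₁ supremum)) u v
      to {u} {v} (r , s) =
        let p , u≈ , v≈ = S-trail {u} {v} s in
        p
        , proj₁ (proj₂ supremum) ∣ ends p ∣
            (end p , refl , proj₁ (reroot {R} inv p) (at-trail R {u} {v} {p} u≈ v≈ r))
        , u≈ , v≈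
      from : ∀ {u v} → rel (h (proj₁ supremum)) u v → rel (R ⊓ S) u v
      from {u} {v} r@(p , le , u≈ , v≈) =
        from-trail R {u} {v} {p} u≈ v≈ (occurs⇒ p (below⇒occurs (ends p) le))
        , h⊆S {proj₁ supremum} {u} {v} r

  h-⊓-S : ∀ x → h x Re.≈ (h x ⊓ S)
  h-⊓-S x = ext ((λ {u} {v} r → r , h⊆S {x} {u} {v} r) , proj₁)

  in-universe : ∀ {X x} → X Re.≈ h x → RlUniverse S invariant X
  in-universe {X} {x} X≈hx = h x , Level.lift (h-invariant x) , Re.trans {X} {h x} {h x ⊓ S} X≈hx (h-⊓-S x)

  from-universe : ∀ {X} → RlUniverse S invariant X → ∃[ x ] X Re.≈ h x
  from-universe {X} (R , Level.lift inv , X≈) =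
    proj₁ (supremum R inv) , Re.trans {X} {R ⊓ S} {h (proj₁ (supremum R inv))} X≈ (h-supremum R inv)

  -- The relativized universe consists exactly of the relations `h x`, so closure can be read off
  -- from the homomorphism laws of `h`.
  closed : RlClosed S invariant
  closed = record
    { respects  = λ { {X} {Y} X≈Y X∈ →
        let x , X≈ = from-universe X∈ in
        in-universe {Y} {x} (Re.trans {Y} {X} {h x} (Re.sym {X} {Y} X≈Y) X≈) }
    ; +-closed  = λ { {X} {Y} X∈ Y∈ →
        let x , X≈ = from-universe X∈
            y , Y≈ = from-universe Y∈ in
        in-universe {X Rl.+ Y} {x + y} (Re.trans {X Rl.+ Y} {h x Rl.+ h y} {h (x + y)}
          (Rl.+-cong {X} {h x} {Y} {h y} X≈ Y≈) (Re.sym {h (x + y)} {h x Rl.+ h y} (h-+ x y))) }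
    ; -‿closed  = λ { {X} X∈ →
        let x , X≈ = from-universe X∈ in
        in-universe {Rl.- X} { - x} (Re.trans {Rl.- X} {Rl.- h x} {h (- x)}
          (Rl.-‿cong {X} {h x} X≈) (Re.sym {h (- x)} {Rl.- h x} (h-‿ x))) }
    ; ⨾-closed  = λ { {X} {Y} X∈ Y∈ →
        let x , X≈ = from-universe X∈
            y , Y≈ = from-universe Y∈ in
        in-universe {X Rl.⨾ Y} {x ⨾ y} (Re.trans {X Rl.⨾ Y} {h x Rl.⨾ h y} {h (x ⨾ y)}
          (Rl.⨾-cong {X} {h x} {Y} {h y} X≈ Y≈) (Re.sym {h (x ⨾ y)} {h x Rl.⨾ h y} (h-⨾ x y))) }
    ; ˘-closed  = λ { {X} X∈ →
        let x , X≈ = from-universe X∈ in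
        in-universe {X Rl.˘} {x ˘} (Re.trans {X Rl.˘} {h x Rl.˘} {h (x ˘)}
          (Rl.˘-cong {X} {h x} X≈) (Re.sym {h (x ˘)} {h x Rl.˘} (h-˘ x))) }
    ; 1'-closed = in-universe {Rl.1'} {1'} (Re.sym {h 1'} {Rl.1'} h-1')
    }

  isomorphism : WA.algebra 𝔄 ≅ Rl S invariant closed
  isomorphism = record
    { ⟦_⟧       = λ x → h x , in-universe {h x} {x} (Re.refl {h x})
    ; cong      = h-cong
    ; bijective =
        (λ { {x} {y} (ext (f , g)) → ≤-antisym
          (h-reflects-≤ (λ {u} {v} → f {u} {v})) (h-reflects-≤ (λ {u} {v} → g {u} {v})) })
      , (λ { (X , X∈) → let x , X≈ = from-universe X∈ in
          x , λ {z} z≈x → Re.trans {h z} {h x} {X} (h-cong z≈x) (Re.sym {X} {h x} X≈) })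
    ; +-homo    = h-+
    ; -‿homo    = h-‿
    ; ⨾-homo    = h-⨾
    ; ˘-homo    = h-˘
    ; 1'-homo   = h-1'
    }

theorem7 : (∀ {p} → ExcludedMiddle p) →
    ∀ {c ℓ} (𝔄 : WA c ℓ) → Complete 𝔄 → Atomic 𝔄 →
    let open Trails (suitableStructure 𝔄) in
    Σ[ 𝔄′ ∈ Subalgebra (Re U) (suc (c ⊔ ℓ)) ]
    Σ[ closed ∈ RlClosed S 𝔄′ ]
    WA.algebra 𝔄 ≅ Rl S 𝔄′ closed
theorem7 em 𝔄 complete atomic = invariant , closed , isomorphism
  where open Representation em 𝔄 complete atomic
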